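{- Let $d \geq 2$ and $k$ be fixed positive integers. Then every $d$-Horton set $H$ with $n$ points contains at least $\Omega(n^{\min\{2^{d-1},k\}})$ $k$-islands in $H$ (the implied constant depending only on $d$ and $k$). If $k \leq 3 \cdot 2^{d-1}$, then $H$ even contains at least $\Omega(n^{\min\{2^{d-1},k\}})$ $k$-holes in $H$.
   Context: A finite set $S\subseteq\mathbb{R}^d$ is in general position if for every $i=1,\dots,d-1$ no $i+2$ points of $S$ lie in an $i$-dimensional affine subspace. A set $I$ of $k$ points of $S$ is a $k$-island in $S$ if $\mathrm{conv}(I)\cap S=I$; it is a $k$-hole if moreover $I$ is in convex position (equivalently, $I$ is in convex position and the interior of $\mathrm{conv}(I)$ contains no point of $S$). A set $Q\subseteq\mathbb{R}^d$ is in strongly general position if it is in general position and, for every $i=1,\dots,d-1$, no $(i+1)$-tuple of points of $Q$ spans an $i$-dimensional affine subspace parallel to the $(d-i)$-dimensional linear subspace containing the last $d-i$ coordinate axes. Let $\pi:\mathbb{R}^d\to\mathbb{R}^{d-1}$, $\pi(x_1,\dots,x_d)=(x_1,\dots,x_{d-1})$. If $Q=\{q_0,\dots,q_{n-1}\}$ is in strongly general position with the points ordered by increasing first coordinate, then for $m\in\mathbb{N}$ and $i\in\{0,\dots,m-1\}$ let $Q_{i,m}=\{q_j: j\equiv i \pmod m\}$. For $A,B\subseteq\mathbb{R}^d$ with $|A|,|B|\ge d$, $B$ is deep below $A$ (and $A$ high above $B$) if $B$ lies entirely below every hyperplane determined by $d$ points of $A$ and $A$ lies entirely above every hyperplane determined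 by $d$ points of $B$. For arbitrary finite $A',B'$, $B'$ is deep below $A'$ if there are $A\supseteq A'$, $B\supseteq B'$ with $|A|,|B|\ge d$ and $B$ deep below $A$. Let $p_2<p_3<p_4<\cdots$ be the primes ($p_2=2$, $p_3=3$, $p_4=5,\dots$). Every finite set in $\mathbb{R}$ is $1$-Horton. For $d\ge2$, a finite set $H\subseteq\mathbb{R}^d$ in strongly general position is $d$-Horton if either $|H|\le 1$, or: (i) if $d>2$ then $\pi(H)$ is $(d-1)$-Horton; (ii) for every $i\in\{0,\dots,p_d-1\}$ the set $H_{i,p_d}$ is $d$-Horton; (iii) every $I\subseteq\{0,\dots,p_d-1\}$ with $|I|\ge2$ can be partitioned into nonempty $J$ and $I\setminus J$ such that $\bigcup_{j\in J}H_{j,p_d}$ lies deep below $\bigcup_{i\in I\setminus J}H_{i,p_d}$. -}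

module Defs where

open import Level using (0ℓ)
open import Algebra.Bundles using (CommutativeRing)
open import Relation.Binary.Structures using (IsStrictTotalOrder)
open import Relation.Nullary using (¬_; yes; no)
open import Data.Empty using (⊥)
open import Data.Unit using (⊤)
open import Data.Product using (Σ; ∃; _×_; _,_)
open import Data.Sum using (_⊎_)
open import Data.Bool using (Bool; true; false; if_then_else_)
open import Data.Nat using (ℕ; zero; suc; _≤_; _<_; _!; NonZero)
open import Data.Nat.DivMod using (_mod_)
open import Data.Nat.Primality using (prime?)
open import Data.Fin using (Fin; toℕ)
import Data.Fin.Subset
open import Data.Fin.Subset using (Subset; _∈_; _∉_; _⊆_; _─_; ∣_∣; Nonempty; ⁅_⁆)
open import Data.Vec using (lookup)
open import Data.List using (List; []; _∷_; length; map; _++_)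
import Data.List as List
open import Data.List.Relation.Unary.All using (All)
open import Data.List.Relation.Unary.AllPairs using (AllPairs)
open import Data.List.Relation.Unary.Linked using (Linked)
open import Function.Definitions using (Injective)
open import Relation.Binary.PropositionalEquality using (_≡_)

primeFrom : ℕ → ℕ → ℕ
primeFrom zero n = n
primeFrom (suc f) n with prime? n
... | yes _ = n
... | no  _ = primeFrom f (suc n)

-- the least prime > p (by Euclid it is ≤ p! + 1, so the search is complete)
nextPrime : ℕ → ℕ
nextPrime p = primeFrom (p !) (suc p)

-- primeSeq e = p_{e+2}, i.e. primeSeq 0 = 2, primeSeq 1 = 3, primeSeq 2 = 5, ...
primeSeq : ℕ → ℕ
primeSeq zero = 2
primeSeq (suc e) = nextPrime (primeSeq e)

p[_] : ℕ → ℕ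
p[ d ] = primeSeq (d Data.Nat.∸ 2)

primeFrom-nz : ∀ f m → NonZero (primeFrom f (suc m))
primeFrom-nz zero m = _
primeFrom-nz (suc f) m with prime? (suc m)
... | yes _ = _
... | no  _ = primeFrom-nz f (suc m)

primeSeq-nz : ∀ e → NonZero (primeSeq e)
primeSeq-nz zero = _
primeSeq-nz (suc e) = primeFrom-nz (primeSeq e !) (primeSeq e)

-- Ordered fields (the coordinates; ℝ is the intended instance)

record OrderedField : Set₁ where
  field
    commutativeRing : CommutativeRing 0ℓ 0ℓ
  open CommutativeRing commutativeRing public
  field
    _<ᶠ_ : Carrier → Carrier → Set
    <-isStrictTotalOrder : IsStrictTotalOrder _≈_ _<ᶠ_
    <-+-mono : ∀ {a b} c → a <ᶠ b → (a + c) <ᶠ (b + c)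
    <-*-pos : ∀ {a b} → 0# <ᶠ a → 0# <ᶠ b → 0# <ᶠ (a * b)
    0<1 : 0# <ᶠ 1#
    inverse : ∀ a → ¬ (a ≈ 0#) → ∃ λ b → (a * b) ≈ 1#

  _≤ᶠ_ : Carrier → Carrier → Set
  a ≤ᶠ b = (a <ᶠ b) ⊎ (a ≈ b)

module Geometry (F : OrderedField) where
  open OrderedField F

  Point : ℕ → Set
  Point d = Fin d → Carrier

  ∑ : ∀ n → (Fin n → Carrier) → Carrier
  ∑ zero f = 0#
  ∑ (suc n) f = f Data.Fin.zero + ∑ n (λ j → f (Data.Fin.suc j))

  π : ∀ {d} → Point (suc d) → Point d
  π x c = x (Data.Fin.inject₁ c)

  lastCoord : ∀ {d} → Point (suc d) → Carrier
  lastCoord {d} x = x (Data.Fin.fromℕ d)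

  firstCoord : ∀ {d} → Point (suc d) → Carrier
  firstCoord x = x Data.Fin.zero

  comb : ∀ {d m} → (Fin m → Carrier) → (Fin m → Point d) → Point d
  comb {m = m} λ' q c = ∑ m (λ j → λ' j * q j c)

  AffDep : ∀ {d m} → (Fin m → Point d) → Set
  AffDep {d} {m} q = ∃ λ (λ' : Fin m → Carrier) →
    (∑ m λ' ≈ 0#) × (∀ c → comb λ' q c ≈ 0#) × (∃ λ j → ¬ (λ' j ≈ 0#))

  -- the (affinely independent) points q span an affine subspace parallel to
  -- the linear subspace L spanned by the coordinate axes with index ≥ i
  -- (0-based), i.e. whose direction space meets L in a nonzero vector
  ParallelToAxes : ∀ {d m} → ℕ → (Fin m → Point d) → Set
  ParallelToAxes {d} {m} i q = (¬ AffDep q) × (∃ λ (λ' : Fin m → Carrier) →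
    (∑ m λ' ≈ 0#) × (∀ (c : Fin d) → toℕ c < i → comb λ' q c ≈ 0#) ×
    (∃ λ c → ¬ (comb λ' q c ≈ 0#)))

  pt : ∀ {d} (S : List (Point d)) → Fin (length S) → Point d
  pt S = List.lookup S

  GeneralPosition : ∀ {d} → List (Point d) → Set
  GeneralPosition {d} S = ∀ i → 1 ≤ i → i < d →
    (t : Fin (suc (suc i)) → Fin (length S)) → Injective _≡_ _≡_ t →
    ¬ AffDep (λ j → pt S (t j))

  StronglyGeneralPosition : ∀ {d} → List (Point d) → Set
  StronglyGeneralPosition {d} S = GeneralPosition S × (∀ i → 1 ≤ i → i < d →
    (t : Fin (suc i) → Fin (length S)) → Injective _≡_ _≡_ t →
    ¬ ParallelToAxes i (λ j → pt S (t j)))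

  -- list representation of a finite set: strictly increasing first coordinate
  SortedByFirst : ∀ {d} → List (Point (suc d)) → Set
  SortedByFirst = Linked (λ x y → firstCoord x <ᶠ firstCoord y)

  DistinctPoints : ∀ {d} → List (Point d) → Set
  DistinctPoints = AllPairs (λ x y → ¬ (∀ c → x c ≈ y c))

  InConv : ∀ {d} (S : List (Point d)) → Subset (length S) → Point d → Set
  InConv S I x = ∃ λ (λ' : Fin (length S) → Carrier) →
    (∀ j → 0# ≤ᶠ λ' j) × (∀ j → j ∉ I → λ' j ≈ 0#) ×
    (∑ (length S) λ' ≈ 1#) × (∀ c → comb λ' (pt S) c ≈ x c)

  IsIsland : ∀ {d} → ℕ → (S : List (Point d)) → Subset (length S) → Set
  IsIsland k S I = (∣ I ∣ ≡ k) × (∀ j → InConv S I (pt S j) → j ∈ I)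

  ConvexPosition : ∀ {d} (S : List (Point d)) → Subset (length S) → Set
  ConvexPosition S I = ∀ j → j ∈ I → ¬ InConv S (I Data.Fin.Subset.- j) (pt S j)

  IsHole : ∀ {d} → ℕ → (S : List (Point d)) → Subset (length S) → Set
  IsHole k S I = IsIsland k S I × ConvexPosition S I

  -- the hyperplane through a_0,…,a_{d-1} (non-vertical, i.e. the graph of
  -- an affine function x_d = w·(x_1..x_{d-1}) + w₀) has all of B strictly
  -- below it.  (A vertical hyperplane has nothing below it.)
  affineFn : ∀ {e} → Point e → Carrier → Point e → Carrier
  affineFn {e} w w₀ y = ∑ e (λ c → w c * y c) + w₀

  AllBelowHyperplane : ∀ {e} → (Fin (suc e) → Point (suc e)) → List (Point (suc e)) → Set
  AllBelowHyperplane {e} a B = ∃ λ (w : Point e) → ∃ λ (w₀ : Carrier) →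
    (∀ j → affineFn w w₀ (π (a j)) ≈ lastCoord (a j)) ×
    All (λ b → lastCoord b <ᶠ affineFn w w₀ (π b)) B

  AllAboveHyperplane : ∀ {e} → (Fin (suc e) → Point (suc e)) → List (Point (suc e)) → Set
  AllAboveHyperplane {e} a B = ∃ λ (w : Point e) → ∃ λ (w₀ : Carrier) →
    (∀ j → affineFn w w₀ (π (a j)) ≈ lastCoord (a j)) ×
    All (λ b → affineFn w w₀ (π b) <ᶠ lastCoord b) B

  BelowAllHyperplanes : ∀ {e} → (B A : List (Point (suc e))) → Set
  BelowAllHyperplanes {e} B A =
    (t : Fin (suc e) → Fin (length A)) → Injective _≡_ _≡_ t →
    ¬ AffDep (λ j → pt A (t j)) → AllBelowHyperplane (λ j → pt A (t j)) B

  AboveAllHyperplanes : ∀ {e} → (A B : List (Point (suc e))) → Set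
  AboveAllHyperplanes {e} A B =
    (t : Fin (suc e) → Fin (length B)) → Injective _≡_ _≡_ t →
    ¬ AffDep (λ j → pt B (t j)) → AllAboveHyperplane (λ j → pt B (t j)) A

  DeepBelow₀ : ∀ {e} → (B A : List (Point (suc e))) → Set
  DeepBelow₀ {e} B A = (suc e ≤ length A) × (suc e ≤ length B) ×
    BelowAllHyperplanes B A × AboveAllHyperplanes A B

  -- B' deep below A' for arbitrary finite sets: A = A' ∪ EA, B = B' ∪ EB
  DeepBelow : ∀ {e} → (B' A' : List (Point (suc e))) → Set
  DeepBelow B' A' = ∃ λ EA → ∃ λ EB →
    DistinctPoints (A' ++ EA) × DistinctPoints (B' ++ EB) ×
    DeepBelow₀ (B' ++ EB) (A' ++ EA)

  selectIdx : ∀ {A : Set} → (ℕ → Bool) → ℕ → List A → List A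
  selectIdx P k₀ [] = []
  selectIdx P k₀ (x ∷ xs) =
    if P k₀ then x ∷ selectIdx P (suc k₀) xs else selectIdx P (suc k₀) xs

  -- ⋃_{j ∈ J} H_{j,p}  (H listed by increasing first coordinate)
  unionClasses : ∀ {A : Set} (p : ℕ) .{{_ : NonZero p}} → Subset p → List A → List A
  unionClasses p J H = selectIdx (λ k → lookup J (k mod p)) 0 H

  classOf : ∀ {A : Set} (p : ℕ) .{{_ : NonZero p}} → Fin p → List A → List A
  classOf p i H = unionClasses p ⁅ i ⁆ H

  -- d-Horton sets, d = e + 2, with p_d = primeSeq e.
  data Horton : (d : ℕ) → List (Point d) → Set

  ProjCond : (e : ℕ) → List (Point (suc (suc e))) → Set
  ProjCond zero H = ⊤
  ProjCond (suc e) H = Horton (suc (suc e)) (map π H)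

  SplitCond : (e : ℕ) → List (Point (suc (suc e))) → Set
  SplitCond e H = ∀ (I : Subset (primeSeq e)) → 2 ≤ ∣ I ∣ →
    ∃ λ (J : Subset (primeSeq e)) → J ⊆ I × Nonempty J × Nonempty (I ─ J) ×
      DeepBelow (unionClasses (primeSeq e) {{primeSeq-nz e}} J H)
                (unionClasses (primeSeq e) {{primeSeq-nz e}} (I ─ J) H)

  data Horton where
    horton : ∀ {e} (H : List (Point (suc (suc e)))) →
      SortedByFirst H → StronglyGeneralPosition H →
      (length H ≤ 1 ⊎
        (ProjCond e H ×
         (∀ (i : Fin (primeSeq e)) →
            Horton (suc (suc e)) (classOf (primeSeq e) {{primeSeq-nz e}} i H)) ×
         SplitCond e H)) →
      Horton (suc (suc e)) H

{-# OPTIONS --safe #-}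
module Submission where

-- Split the residue classes of a d-Horton set H into an upper part A and a lower part B, take the
-- lowest class H_j of A and the highest class H_i of B, and choose X ⊆ H_j and Y ⊆ H_i.  As B is
-- deep below A, a point of A in conv (X ∪ Y) lies under conv X with respect to the last coordinate;
-- it belongs to H_j because the other classes of A are high above H_j.  Hence its projection lies
-- in conv (π X), and X ∪ Y is an island (a hole) of H as soon as π X and π Y are islands (holes) of
-- the (d-1)-Horton sets π H_j and π H_i.  Taking half of the k points on either side doubles the
-- exponent with every dimension.  In the plane X and Y consist of consecutive points of H_j and
-- H_i; three consecutive points stay in convex position if X is a cap and Y a cup, which is
-- decided by the parity of the first point.

open import Defs
open import Level using (0ℓ)
open import Algebra.Bundles using (CommutativeMonoid)
open import Data.Nat using (ℕ; _≤_; _*_; _^_; _⊓_; _∸_; zero; suc; NonZero; ⌊_/2⌋; ⌈_/2⌉)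
import Data.Nat as ℕ
import Data.Nat.Properties as ℕ
open import Data.Nat.DivMod
  using (_mod_; _/_; _%_; [m+kn]%n≡m%n; m<n⇒m%n≡m; m/n*n≤m; m*n/n≡m; /-monoˡ-≤; m≡m%n+[m/n]*n; m%n<n)
open import Data.Nat.Primality using (prime?)
open import Data.Product using (∃; _×_; _,_; proj₁; proj₂; map₂)
open import Data.Sum using (_⊎_; inj₁; inj₂; swap)
open import Data.Empty using () renaming (⊥ to ⊥′)
open import Data.Unit using (tt) renaming (⊤ to ⊤′)
open import Data.Bool using (Bool; true; false; if_then_else_)
open import Data.Fin using (Fin; zero; suc; toℕ)
import Data.Fin as Fin
open import Data.Fin.Properties
  using (any?; suc-injective; 0≢1+n; injective⇒≤; toℕ<n; toℕ-injective; toℕ-fromℕ<)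
open import Data.Fin.Subset
open import Data.Fin.Subset.Properties
open import Data.Vec using ([]; _∷_; here; there; tabulate)
import Data.Vec as Vec
import Data.Vec.Properties as Vec
open import Data.List using (List; []; _∷_; length; _++_; map; applyUpTo; cartesianProductWith)
import Data.List as List
open import Data.List.Properties using (length-map; length-++; length-applyUpTo)
open import Data.List.Membership.Propositional.Properties using (∈-lookup)
open import Data.List.Relation.Binary.Sublist.Heterogeneous using (Sublist; []; _∷_; _∷ʳ_)
open import Data.List.Relation.Binary.Sublist.Propositional using () renaming (_⊆_ to _⊑_; ⊆-refl to ⊑-refl)
open import Data.List.Relation.Binary.Sublist.Propositional.Properties using (++⁺ʳ)
open import Data.List.Relation.Unary.All using (All)
import Data.List.Relation.Unary.All as All
import Data.List.Relation.Unary.All.Properties as All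
open import Data.List.Relation.Unary.AllPairs using (AllPairs; []; _∷_)
open import Data.List.Relation.Unary.Linked.Properties using (Linked⇒AllPairs)
open import Data.List.Relation.Unary.Unique.Propositional using (Unique)
import Data.List.Relation.Unary.Unique.Propositional.Properties as Unique
open import Function using (_∘_)
open import Function.Definitions using (Injective)
open import Relation.Nullary using (¬_; Dec; does; yes; no; contradiction; ¬?; _×-dec_)
open import Relation.Nullary.Decidable using (decidable-stable)
open import Relation.Binary using (StrictTotalOrder; tri<; tri≈; tri>)
open import Relation.Binary.PropositionalEquality as ≡ using (_≡_; _≢_)

-- The crux is the claim on points of A. Deepness speaks only of hyperplanes through d points,
-- whereas a convex combination may involve many. Carathéodory's theorem cuts it to d + 1 points,
-- and the claim is immediate unless one of them is in B. If fewer than d were in A, a hyperplane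
-- through these and the given point a would have B strictly below it, which would force a strictly
-- below it as well. So exactly d are in A. Exchanging a for each of them in turn gives d
-- hyperplanes; the differences from the hyperplane through all d are, up to positive factors,
-- barycentric coordinate functions, and their signs put the projection of a inside the projected
-- simplex. For d > 2 the heights can then be forgotten. In the plane they cannot: on a line, every
-- point between two others is in their hull, so three-point holes need the cap. A fourth
-- consecutive point would spoil the cap, its lower neighbour being under a segment of the upper
-- parity; hence 3 points per planar class and 3 · 2^(d-1) after d - 1 doublings. The exponent
-- starts at 1, as the start of an interval is the only free choice.

module OrderedFieldProperties (F : OrderedField) where
  open OrderedField F hiding (zero; _-_) renaming (_*_ to _*ᶠ_)
  open Geometry F using (∑)

  open import Algebra.Properties.Ring ring public using (-‿distribʳ-*; -‿distribˡ-*; -‿involutive; -0#≈0#; -1*x≈-x; -‿+-comm)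
  open import Algebra.Properties.CommutativeSemigroup *-commutativeSemigroup public using (x∙yz≈y∙xz)
  open import Algebra.Properties.CommutativeSemigroup
    (CommutativeMonoid.commutativeSemigroup +-commutativeMonoid) using (interchange)

  strictTotalOrder : StrictTotalOrder 0ℓ 0ℓ 0ℓ
  strictTotalOrder = record { isStrictTotalOrder = <-isStrictTotalOrder }

  open StrictTotalOrder strictTotalOrder using (compare; _≟_; _<?_; <-resp-≈; irrefl; strictPartialOrder)
    renaming (trans to <-trans) public
  open import Relation.Binary.Reasoning.StrictPartialOrder strictPartialOrder
    using (begin_; begin-strict_; begin-equality_; step-<; step-≤; step-≈-⟩; step-≈-⟨; _∎) public

  private
    variable
      a b c x y : Carrier

  -- Order and arithmetic in an ordered field

  ≤-refl : a ≤ᶠ a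
  ≤-refl = inj₂ refl

  ≤-trans : a ≤ᶠ b → b ≤ᶠ c → a ≤ᶠ c
  ≤-trans {a} {b} {c} a≤b b≤c = begin
    a ≤⟨ a≤b ⟩
    b ≤⟨ b≤c ⟩
    c ∎

  <⇒≱ : a <ᶠ b → ¬ (b ≤ᶠ a)
  <⇒≱ a<b (inj₁ b<a) = irrefl refl (<-trans a<b b<a)
  <⇒≱ a<b (inj₂ b≈a) = irrefl (sym b≈a) a<b

  ≮⇒≥ : ¬ (a <ᶠ b) → b ≤ᶠ a
  ≮⇒≥ {a} {b} a≮b with compare a b
  ... | tri< a<b _ _ = contradiction a<b a≮b
  ... | tri≈ _ a≈b _ = inj₂ (sym a≈b)
  ... | tri> _ _ b<a = inj₁ b<a

  <-respˡ : a ≈ b → a <ᶠ c → b <ᶠ c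
  <-respˡ = proj₂ <-resp-≈

  <-respʳ : a ≈ b → c <ᶠ a → c <ᶠ b
  <-respʳ = proj₁ <-resp-≈

  +-monoˡ-≤ : ∀ c → a ≤ᶠ b → (a + c) ≤ᶠ (b + c)
  +-monoˡ-≤ c (inj₁ a<b) = inj₁ (<-+-mono c a<b)
  +-monoˡ-≤ c (inj₂ a≈b) = inj₂ (+-congʳ a≈b)

  +-monoʳ-≤ : ∀ c → a ≤ᶠ b → (c + a) ≤ᶠ (c + b)
  +-monoʳ-≤ {a} {b} c a≤b = begin
    c + a ≈⟨ +-comm c a ⟩
    a + c ≤⟨ +-monoˡ-≤ c a≤b ⟩
    b + c ≈⟨ +-comm b c ⟩
    c + b ∎

  <-+-monoʳ : ∀ c → a <ᶠ b → (c + a) <ᶠ (c + b)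
  <-+-monoʳ {a} {b} c a<b = begin-strict
    c + a ≈⟨ +-comm c a ⟩
    a + c <⟨ <-+-mono c a<b ⟩
    b + c ≈⟨ +-comm b c ⟩
    c + b ∎

  +-mono-≤ : a ≤ᶠ b → x ≤ᶠ y → (a + x) ≤ᶠ (b + y)
  +-mono-≤ {a} {b} {x} {y} a≤b x≤y = begin
    a + x ≤⟨ +-monoˡ-≤ x a≤b ⟩
    b + x ≤⟨ +-monoʳ-≤ b x≤y ⟩
    b + y ∎

  +-mono-<-≤ : a <ᶠ b → x ≤ᶠ y → (a + x) <ᶠ (b + y)
  +-mono-<-≤ {a} {b} {x} {y} a<b x≤y = begin-strict
    a + x <⟨ <-+-mono x a<b ⟩
    b + x ≤⟨ +-monoʳ-≤ b x≤y ⟩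
    b + y ∎

  +-mono-≤-< : a ≤ᶠ b → x <ᶠ y → (a + x) <ᶠ (b + y)
  +-mono-≤-< {a} {b} {x} {y} a≤b x<y = begin-strict
    a + x <⟨ <-+-monoʳ a x<y ⟩
    a + y ≤⟨ +-monoˡ-≤ y a≤b ⟩
    b + y ∎

  x<y⇒0<y-x : x <ᶠ y → 0# <ᶠ (y + (- x))
  x<y⇒0<y-x {x} {y} x<y = begin-strict
    0#        ≈⟨ -‿inverseʳ x ⟨
    x + (- x) <⟨ <-+-mono (- x) x<y ⟩
    y + (- x) ∎

  x≤y⇒0≤y-x : x ≤ᶠ y → 0# ≤ᶠ (y + (- x))
  x≤y⇒0≤y-x (inj₁ x<y) = inj₁ (x<y⇒0<y-x x<y)
  x≤y⇒0≤y-x {x} {y} (inj₂ x≈y) = inj₂ (trans (sym (-‿inverseʳ x)) (+-congʳ x≈y))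

  x<0⇒0<-x : x <ᶠ 0# → 0# <ᶠ (- x)
  x<0⇒0<-x x<0 = <-respʳ (+-identityˡ _) (x<y⇒0<y-x x<0)

  0<-x⇒x<0 : 0# <ᶠ (- x) → x <ᶠ 0#
  0<-x⇒x<0 {x} 0<-x = begin-strict
    x          ≈⟨ +-identityˡ x ⟨
    0# + x     <⟨ <-+-mono x 0<-x ⟩
    (- x) + x  ≈⟨ -‿inverseˡ x ⟩
    0#         ∎

  -‿anti-< : x <ᶠ y → (- y) <ᶠ (- x)
  -‿anti-< {x} {y} x<y = begin-strict
    - y                  ≈⟨ lemma x y ⟩
    x + ((- x) + (- y))  <⟨ <-+-mono _ x<y ⟩
    y + ((- x) + (- y))  ≈⟨ lemma′ x y ⟩
    - x                  ∎
    where
    lemma : ∀ x y → (- y) ≈ (x + ((- x) + (- y)))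
    lemma x y = trans (sym (+-identityˡ _)) (trans (+-congʳ (sym (-‿inverseʳ x))) (+-assoc _ _ _))
    lemma′ : ∀ x y → (y + ((- x) + (- y))) ≈ (- x)
    lemma′ x y = trans (+-congˡ (+-comm _ _)) (sym (lemma y x))

  *-nonneg : 0# ≤ᶠ a → 0# ≤ᶠ b → 0# ≤ᶠ (a *ᶠ b)
  *-nonneg (inj₁ 0<a) (inj₁ 0<b) = inj₁ (<-*-pos 0<a 0<b)
  *-nonneg {a} (inj₁ 0<a) (inj₂ 0≈b) = inj₂ (trans (sym (zeroʳ a)) (*-congˡ 0≈b))
  *-nonneg {a} {b} (inj₂ 0≈a) _ = inj₂ (trans (sym (zeroˡ b)) (*-congʳ 0≈a))

  *-nonneg-nonpos : 0# ≤ᶠ a → b ≤ᶠ 0# → (a *ᶠ b) ≤ᶠ 0#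
  *-nonneg-nonpos {a} {b} 0≤a b≤0 = begin
    a *ᶠ b                        ≈⟨ +-identityˡ _ ⟨
    0# + a *ᶠ b                   ≤⟨ +-monoˡ-≤ _ (*-nonneg 0≤a (≤-resp (+-identityˡ _) (x≤y⇒0≤y-x b≤0))) ⟩
    (a *ᶠ (- b)) + a *ᶠ b          ≈⟨ lemma a b ⟩
    0#                           ∎
    where
    ≤-resp : x ≈ y → c ≤ᶠ x → c ≤ᶠ y
    ≤-resp x≈y (inj₁ c<x) = inj₁ (<-respʳ x≈y c<x)
    ≤-resp x≈y (inj₂ c≈x) = inj₂ (trans c≈x x≈y)
    lemma : ∀ a b → ((a *ᶠ (- b)) + a *ᶠ b) ≈ 0#
    lemma a b = trans (sym (distribˡ a _ _)) (trans (*-congˡ (-‿inverseˡ b)) (zeroʳ a))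

  *-pos-neg : 0# <ᶠ a → b <ᶠ 0# → (a *ᶠ b) <ᶠ 0#
  *-pos-neg {a} {b} 0<a b<0 =
    0<-x⇒x<0 (<-respʳ (sym (-‿distribʳ-* a b)) (<-*-pos 0<a (x<0⇒0<-x b<0)))

  nonneg∧≉0⇒pos : 0# ≤ᶠ a → ¬ (a ≈ 0#) → 0# <ᶠ a
  nonneg∧≉0⇒pos (inj₁ 0<a) _ = 0<a
  nonneg∧≉0⇒pos (inj₂ 0≈a) a≉0 = contradiction (sym 0≈a) a≉0

  pos⇒≉0 : 0# <ᶠ a → ¬ (a ≈ 0#)
  pos⇒≉0 0<a a≈0 = irrefl (sym a≈0) 0<a

  pos-cancelʳ : 0# <ᶠ b → 0# <ᶠ (a *ᶠ b) → 0# <ᶠ a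
  pos-cancelʳ {b} {a} 0<b 0<ab with compare 0# a
  ... | tri< 0<a _ _ = 0<a
  ... | tri≈ _ 0≈a _ = contradiction (trans (*-congʳ (sym 0≈a)) (zeroˡ b)) (pos⇒≉0 0<ab)
  ... | tri> _ _ a<0 = contradiction (inj₁ (<-respˡ (*-comm b a) (*-pos-neg 0<b a<0))) (<⇒≱ 0<ab)

  *-cancel-0 : ¬ (b ≈ 0#) → (a *ᶠ b) ≈ 0# → a ≈ 0#
  *-cancel-0 {b} {a} b≉0 ab≈0 with inverse b b≉0
  ... | b⁻¹ , bb⁻¹≈1 = trans (trans (trans (sym (*-identityʳ a)) (*-congˡ (sym bb⁻¹≈1)))
                         (sym (*-assoc a b b⁻¹))) (trans (*-congʳ ab≈0) (zeroˡ b⁻¹))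

  inverse-pos : 0# <ᶠ a → (a *ᶠ b) ≈ 1# → 0# <ᶠ b
  inverse-pos {a} {b} 0<a ab≈1 = pos-cancelʳ 0<a (<-respʳ (trans (sym ab≈1) (*-comm a b)) 0<1)

  1≉0 : ¬ (1# ≈ 0#)
  1≉0 = pos⇒≉0 0<1

  private
    variable
      n m : ℕ
      f g : Fin n → Carrier

  -- Finite sums

  ∑-cong : (∀ j → f j ≈ g j) → ∑ n f ≈ ∑ n g
  ∑-cong {n = zero} f≈g = refl
  ∑-cong {n = suc n} f≈g = +-cong (f≈g zero) (∑-cong (f≈g ∘ suc))

  ∑-zero : (∀ j → f j ≈ 0#) → ∑ n f ≈ 0#
  ∑-zero {n = zero} f≈0 = refl
  ∑-zero {n = suc n} f≈0 = trans (+-cong (f≈0 zero) (∑-zero (f≈0 ∘ suc))) (+-identityˡ 0#)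

  ∑-+ : ∀ (f g : Fin n → Carrier) → ∑ n (λ j → f j + g j) ≈ (∑ n f + ∑ n g)
  ∑-+ {zero} f g = sym (+-identityˡ 0#)
  ∑-+ {suc n} f g = trans (+-congˡ (∑-+ (f ∘ suc) (g ∘ suc))) (interchange _ _ _ _)

  ∑-*ˡ : ∀ c (f : Fin n → Carrier) → ∑ n (λ j → c *ᶠ f j) ≈ (c *ᶠ ∑ n f)
  ∑-*ˡ {zero} c f = sym (zeroʳ c)
  ∑-*ˡ {suc n} c f = trans (+-congˡ (∑-*ˡ c (f ∘ suc))) (sym (distribˡ c _ _))

  ∑-*ʳ : ∀ (f : Fin n → Carrier) c → ∑ n (λ j → f j *ᶠ c) ≈ (∑ n f *ᶠ c)
  ∑-*ʳ f c = trans (∑-cong (λ j → *-comm (f j) c)) (trans (∑-*ˡ c f) (*-comm c _))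

  ∑-swap : ∀ (f : Fin n → Fin m → Carrier) →
    ∑ n (λ i → ∑ m (λ j → f i j)) ≈ ∑ m (λ j → ∑ n (λ i → f i j))
  ∑-swap {zero} {m} f = sym (∑-zero {n = m} (λ _ → refl))
  ∑-swap {suc n} {m} f = trans (+-congˡ (∑-swap (f ∘ suc))) (sym (∑-+ {m} (f zero) _))

  ∑-single : ∀ i → (∀ j → j ≢ i → f j ≈ 0#) → ∑ n f ≈ f i
  ∑-single {n = suc n} zero f≈0 =
    trans (+-congˡ (∑-zero (λ j → f≈0 (suc j) λ ()))) (+-identityʳ _)
  ∑-single {n = suc n} (suc i) f≈0 =
    trans (+-cong (f≈0 zero λ ()) (∑-single i λ j j≢i → f≈0 (suc j) λ { ≡.refl → j≢i ≡.refl })) (+-identityˡ _)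

  ∑-mono-≤ : (∀ j → f j ≤ᶠ g j) → ∑ n f ≤ᶠ ∑ n g
  ∑-mono-≤ {n = zero} f≤g = ≤-refl
  ∑-mono-≤ {n = suc n} f≤g = +-mono-≤ (f≤g zero) (∑-mono-≤ (f≤g ∘ suc))

  ∑-mono-< : (∀ j → f j ≤ᶠ g j) → ∀ i → f i <ᶠ g i → ∑ n f <ᶠ ∑ n g
  ∑-mono-< {n = suc n} f≤g zero fi<gi = +-mono-<-≤ fi<gi (∑-mono-≤ (f≤g ∘ suc))
  ∑-mono-< {n = suc n} f≤g (suc i) fi<gi = +-mono-≤-< (f≤g zero) (∑-mono-< (f≤g ∘ suc) i fi<gi)

  ∑-neg : (∀ j → f j ≤ᶠ 0#) → ∀ i → f i <ᶠ 0# → ∑ n f <ᶠ 0#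
  ∑-neg {n = n} f≤0 i fi<0 = <-respʳ (∑-zero {n = n} (λ _ → refl)) (∑-mono-< f≤0 i fi<0)

  ∑-linear : ∀ (f g x : Fin n → Carrier) t →
    ∑ n (λ j → (f j + t *ᶠ g j) *ᶠ x j) ≈ (∑ n (λ j → f j *ᶠ x j) + t *ᶠ ∑ n (λ j → g j *ᶠ x j))
  ∑-linear {n} f g x t = trans
    (∑-cong {n} λ j → trans (distribʳ (x j) (f j) (t *ᶠ g j)) (+-congˡ (*-assoc t (g j) (x j))))
    (trans (∑-+ {n} _ _) (+-congˡ (∑-*ˡ {n} t _)))

  ∑-*-neg : ∀ (f x : Fin n → Carrier) → ∑ n (λ j → f j *ᶠ (- x j)) ≈ (- ∑ n (λ j → f j *ᶠ x j))
  ∑-*-neg {n} f x = trans (∑-cong {n} λ j → trans (sym (-‿distribʳ-* (f j) (x j))) (sym (-1*x≈-x _)))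
    (trans (∑-*ˡ {n} _ _) (-1*x≈-x _))

  *-monoʳ-≤ : 0# ≤ᶠ c → a ≤ᶠ b → (a *ᶠ c) ≤ᶠ (b *ᶠ c)
  *-monoʳ-≤ {c} {a} {b} 0≤c a≤b = begin
    a *ᶠ c                                ≈⟨ +-identityˡ _ ⟨
    0# + a *ᶠ c                           ≤⟨ +-monoˡ-≤ _ (*-nonneg (x≤y⇒0≤y-x a≤b) 0≤c) ⟩
    ((b + (- a)) *ᶠ c) + a *ᶠ c            ≈⟨ distribʳ c _ a ⟨
    ((b + (- a)) + a) *ᶠ c                ≈⟨ *-congʳ (+-assoc b (- a) a) ⟩
    (b + ((- a) + a)) *ᶠ c                ≈⟨ *-congʳ (+-congˡ (-‿inverseˡ a)) ⟩
    (b + 0#) *ᶠ c                         ≈⟨ *-congʳ (+-identityʳ b) ⟩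
    b *ᶠ c                                ∎

  δ : Fin n → Fin n → Carrier
  δ i j = if does (i Fin.≟ j) then 1# else 0#

  δ-refl : ∀ (i : Fin n) → δ i i ≈ 1#
  δ-refl i with i Fin.≟ i
  ... | yes _ = refl
  ... | no i≢i = contradiction ≡.refl i≢i

  δ-≢ : ∀ {i j : Fin n} → j ≢ i → δ i j ≈ 0#
  δ-≢ {i = i} {j} j≢i with i Fin.≟ j
  ... | yes i≡j = contradiction (≡.sym i≡j) j≢i
  ... | no _ = refl

  ∑-δ : ∀ (i : Fin n) (f : Fin n → Carrier) → ∑ n (λ j → δ i j *ᶠ f j) ≈ f i
  ∑-δ i f = trans (∑-single i λ j j≢i → trans (*-congʳ (δ-≢ j≢i)) (zeroˡ (f j)))
    (trans (*-congʳ (δ-refl i)) (*-identityˡ (f i)))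

  -- Totalised with the default 0 at 0, so that pivots and ratios are plain terms; conclusions are
  -- drawn from it only at nonzero arguments.
  _⁻¹ : Carrier → Carrier
  a ⁻¹ with a ≟ 0#
  ... | yes _ = 0#
  ... | no a≉0 = proj₁ (inverse a a≉0)

  ⁻¹-inverse : ¬ (a ≈ 0#) → (a *ᶠ a ⁻¹) ≈ 1#
  ⁻¹-inverse {a} a≉0 with a ≟ 0#
  ... | yes a≈0 = contradiction a≈0 a≉0
  ... | no a≉0′ = proj₂ (inverse a a≉0′)

  argmin : {P : Fin n → Set} → (∀ j → Dec (P j)) → (f : Fin n → Carrier) → ∃ P →
    ∃ λ i → P i × (∀ j → P j → f i ≤ᶠ f j)
  argmin {n = suc n} {P} P? f ∃P with any? (P? ∘ suc)
  ... | no ¬P = zero , P-zero ∃P , λ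
        { zero _ → ≤-refl
        ; (suc j) Pj → contradiction (j , Pj) ¬P }
    where
    P-zero : ∃ P → P zero
    P-zero (zero , p) = p
    P-zero (suc j , p) = contradiction (j , p) ¬P
  ... | yes ∃P′ with argmin (P? ∘ suc) (f ∘ suc) ∃P′ | P? zero
  ...   | i , Pi , min | no ¬P0 = suc i , Pi , λ
          { zero P0 → contradiction P0 ¬P0
          ; (suc j) Pj → min j Pj }
  ...   | i , Pi , min | yes P0 with compare (f zero) (f (suc i))
  ...     | tri< f0<fi _ _ = zero , P0 , λ
            { zero _ → ≤-refl
            ; (suc j) Pj → ≤-trans (inj₁ f0<fi) (min j Pj) }
  ...     | tri≈ _ f0≈fi _ = zero , P0 , λ
            { zero _ → ≤-refl
            ; (suc j) Pj → ≤-trans (inj₂ f0≈fi) (min j Pj) }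
  ...     | tri> _ _ fi<f0 = suc i , Pi , λ
            { zero _ → inj₁ fi<f0
            ; (suc j) Pj → min j Pj }

0<∣p∣⇒Nonempty : ∀ {n} (p : Subset n) → 0 ℕ.< ∣ p ∣ → Nonempty p
0<∣p∣⇒Nonempty {n} p 0<∣p∣ with nonempty? p
... | yes p≢∅ = p≢∅
... | no p≡∅ = contradiction (≡.subst (0 ℕ.<_) (≡.trans (≡.cong ∣_∣ (Empty-unique p≡∅)) (∣⊥∣≡0 n)) 0<∣p∣) λ ()

∣p∣≤1+∣p-x∣ : ∀ {n} (p : Subset n) x → ∣ p ∣ ℕ.≤ suc ∣ p - x ∣
∣p∣≤1+∣p-x∣ (outside ∷ p) zero = ℕ.≤-trans (ℕ.≤-reflexive (≡.cong ∣_∣ (≡.sym (p─⊥≡p p)))) (ℕ.n≤1+n _)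
∣p∣≤1+∣p-x∣ (inside ∷ p) zero = ℕ.≤-reflexive (≡.cong (suc ∘ ∣_∣) (≡.sym (p─⊥≡p p)))
∣p∣≤1+∣p-x∣ (outside ∷ p) (suc x) = ∣p∣≤1+∣p-x∣ p x
∣p∣≤1+∣p-x∣ (inside ∷ p) (suc x) = ℕ.s≤s (∣p∣≤1+∣p-x∣ p x)

x∈p-y⇒x∈p : ∀ {n} {p : Subset n} {x} y → x ∈ p - y → x ∈ p
x∈p-y⇒x∈p {p = p} y = p─q⊆p p ⁅ y ⁆

x∉p-x : ∀ {n} (p : Subset n) x → x ∉ p - x
x∉p-x (_ ∷ p) zero ()
x∉p-x (_ ∷ p) (suc x) (there x∈) = x∉p-x p x x∈

x∉p-y⇒x∉p⊎x≡y : ∀ {n} {p : Subset n} {x y} → x ∉ p - y → x ∉ p ⊎ x ≡ y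
x∉p-y⇒x∉p⊎x≡y {p = p} {x} {y} x∉ with x ∈? p | x Fin.≟ y
... | no x∉p | _ = inj₁ x∉p
... | yes _ | yes x≡y = inj₂ x≡y
... | yes x∈p | no x≢y = contradiction (x∈p∧x≢y⇒x∈p-y x∈p x≢y) x∉

-- Affine dependencies and Carathéodory's theorem

module Convexity (F : OrderedField) where
  open OrderedField F hiding (zero; _-_) renaming (_*_ to _*ᶠ_)
  open Geometry F
  open OrderedFieldProperties F

  private
    variable
      n m e : ℕ

  Supported : Subset n → (Fin n → Carrier) → Set
  Supported S f = ∀ j → j ∉ S → f j ≈ 0#

  Nonneg : (Fin n → Carrier) → Set
  Nonneg f = ∀ j → 0# ≤ᶠ f j

  Supported-∑ : ∀ {S : Subset n} {f x : Fin n → Carrier} → Supported S f →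
    (∀ j → j ∈ S → x j ≈ 0#) → ∑ n (λ j → f j *ᶠ x j) ≈ 0#
  Supported-∑ {S = S} {f} {x} supp x≈0 = ∑-zero λ j → case j (j ∈? S)
    where
    case : ∀ j → Dec (j ∈ S) → (f j *ᶠ x j) ≈ 0#
    case j (yes j∈S) = trans (*-congˡ (x≈0 j j∈S)) (zeroʳ (f j))
    case j (no j∉S) = trans (*-congʳ (supp j j∉S)) (zeroˡ (x j))

  Supported-∑-cong : ∀ {S : Subset n} {f x y : Fin n → Carrier} → Supported S f →
    (∀ j → j ∈ S → x j ≈ y j) → ∑ n (λ j → f j *ᶠ x j) ≈ ∑ n (λ j → f j *ᶠ y j)
  Supported-∑-cong {S = S} {f} {x} {y} supp x≈y = ∑-cong λ j → case j (j ∈? S)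
    where
    case : ∀ j → Dec (j ∈ S) → (f j *ᶠ x j) ≈ (f j *ᶠ y j)
    case j (yes j∈S) = *-congˡ (x≈y j j∈S)
    case j (no j∉S) = trans (*-congʳ (supp j j∉S)) (trans (zeroˡ (x j))
      (sym (trans (*-congʳ (supp j j∉S)) (zeroˡ (y j)))))

  Supported-pos : ∀ {S : Subset n} {f : Fin n → Carrier} {j} → Supported S f → ¬ (f j ≈ 0#) → j ∈ S
  Supported-pos {S = S} {j = j} supp fj≉0 = decidable-stable (j ∈? S) λ j∉S → fj≉0 (supp j j∉S)

  Supported-lin : ∀ {S : Subset n} {f g : Fin n → Carrier} t → Supported S f → Supported S g →
    Supported S (λ j → f j + t *ᶠ g j)
  Supported-lin t f-supp g-supp j j∉S = trans
    (+-cong (f-supp j j∉S) (trans (*-congˡ (g-supp j j∉S)) (zeroʳ t))) (+-identityˡ 0#)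

  Supported-δ : ∀ {S : Subset n} {i} → i ∈ S → Supported S (δ i)
  Supported-δ {i = i} i∈S j j∉S = δ-≢ {i = i} {j} λ { ≡.refl → j∉S i∈S }

  δ-≉0 : ∀ (i : Fin n) → ¬ (δ i i ≈ 0#)
  δ-≉0 i δ≈0 = 1≉0 (trans (sym (δ-refl i)) δ≈0)

  -- Gaussian elimination: a pivot clears the first coordinate of the other vectors, and the
  -- induction treats the remaining coordinates on one index fewer.
  dependency : ∀ m (u : Fin n → Fin m → Carrier) (S : Subset n) → m ℕ.< ∣ S ∣ →
    ∃ λ (ν : Fin n → Carrier) → Supported S ν × (∀ c → ∑ n (λ j → ν j *ᶠ u j c) ≈ 0#) ×
      ∃ λ j → ¬ (ν j ≈ 0#)
  dependency zero u S 0<∣S∣ with 0<∣p∣⇒Nonempty S 0<∣S∣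
  ... | p , p∈S = δ p , Supported-δ p∈S , (λ ()) , p , δ-≉0 p
  dependency {n} (suc m) u S 1+m<∣S∣ with any? (λ j → (j ∈? S) ×-dec ¬? (u j zero ≟ 0#))
  ... | no ¬pivot with dependency m (λ j → u j ∘ suc) S (ℕ.<-trans (ℕ.n<1+n m) 1+m<∣S∣)
  ...   | ν , supp , dep , ν≉0 = ν , supp , (λ { zero → Supported-∑ supp u≈0 ; (suc c) → dep c }) , ν≉0
    where
    u≈0 : ∀ j → j ∈ S → u j zero ≈ 0#
    u≈0 j j∈S = decidable-stable (u j zero ≟ 0#) λ u≉0 → ¬pivot (j , j∈S , u≉0)
  dependency {n} (suc m) u S 1+m<∣S∣ | yes (p , p∈S , up≉0)
    -- The remaining coordinates of `u j` after subtracting the multiple of the pivot vector that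
    -- cancels the first one.
    with dependency m (λ j c → u j (suc c) + ((- (u p zero ⁻¹)) *ᶠ u p (suc c)) *ᶠ u j zero) (S - p)
           (ℕ.s≤s⁻¹ (ℕ.≤-trans 1+m<∣S∣ (∣p∣≤1+∣p-x∣ S p)))
  ... | ν , supp , dep , i , νi≉0 =
        ν′ , Supported-lin k supp′ (Supported-δ p∈S) , (λ { zero → dep-zero ; (suc c) → dep-suc c }) , i , ν′i≉0
    where
    r s k : Carrier
    r = u p zero ⁻¹
    s = ∑ n (λ j → ν j *ᶠ u j zero)
    -- The weight given back to the pivot: it cancels the weighted sum `s` of the first coordinates.
    k = s *ᶠ (- r)
    ν′ : Fin n → Carrier
    ν′ j = ν j + k *ᶠ δ p j
    supp′ : Supported S ν
    supp′ j j∉S = supp j (j∉S ∘ x∈p-y⇒x∈p p)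
    ∑-ν′ : ∀ (x : Fin n → Carrier) → ∑ n (λ j → ν′ j *ᶠ x j) ≈ (∑ n (λ j → ν j *ᶠ x j) + k *ᶠ x p)
    ∑-ν′ x = trans (∑-linear ν (δ p) x k) (+-congˡ (*-congˡ (∑-δ p x)))
    dep-zero : ∑ n (λ j → ν′ j *ᶠ u j zero) ≈ 0#
    dep-zero = trans (∑-ν′ (λ j → u j zero)) (begin-equality
      s + (s *ᶠ (- r)) *ᶠ u p zero  ≈⟨ +-congˡ (trans (*-assoc s _ _) (*-congˡ (sym (-‿distribˡ-* r _)))) ⟩
      s + s *ᶠ (- (r *ᶠ u p zero))  ≈⟨ +-congˡ (*-congˡ (-‿cong (trans (*-comm r _) (⁻¹-inverse up≉0)))) ⟩
      s + s *ᶠ (- 1#)              ≈⟨ +-congʳ (*-identityʳ s) ⟨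
      s *ᶠ 1# + s *ᶠ (- 1#)         ≈⟨ distribˡ s _ _ ⟨
      s *ᶠ (1# + (- 1#))           ≈⟨ *-congˡ (-‿inverseʳ 1#) ⟩
      s *ᶠ 0#                      ≈⟨ zeroʳ s ⟩
      0#                          ∎)
    dep-suc : ∀ c → ∑ n (λ j → ν′ j *ᶠ u j (suc c)) ≈ 0#
    dep-suc c = trans (∑-ν′ (λ j → u j (suc c))) (begin-equality
      ∑ n (λ j → ν j *ᶠ u j (suc c)) + (s *ᶠ (- r)) *ᶠ w
        ≈⟨ +-congˡ (trans (*-assoc s _ _) (*-comm s _)) ⟩
      ∑ n (λ j → ν j *ᶠ u j (suc c)) + ((- r) *ᶠ w) *ᶠ s
        ≈⟨ +-congˡ (∑-*ˡ {n} _ _) ⟨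
      ∑ n (λ j → ν j *ᶠ u j (suc c)) + ∑ n (λ j → ((- r) *ᶠ w) *ᶠ (ν j *ᶠ u j zero))
        ≈⟨ ∑-+ {n} _ _ ⟨
      ∑ n (λ j → ν j *ᶠ u j (suc c) + ((- r) *ᶠ w) *ᶠ (ν j *ᶠ u j zero))
        ≈⟨ ∑-cong {n} (λ j → trans (distribˡ (ν j) _ _) (+-congˡ (x∙yz≈y∙xz (ν j) _ _))) ⟨
      ∑ n (λ j → ν j *ᶠ (u j (suc c) + ((- r) *ᶠ w) *ᶠ u j zero))
        ≈⟨ dep c ⟩
      0# ∎)
      where w = u p (suc c)
    ν′i≉0 : ¬ (ν′ i ≈ 0#)
    ν′i≉0 ν′i≈0 = νi≉0 (trans (sym (trans (+-congˡ (trans (*-congˡ (δ-≢ {i = p} {i} i≢p)) (zeroʳ k)))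
        (+-identityʳ (ν i)))) ν′i≈0)
      where
      i≢p : i ≢ p
      i≢p ≡.refl = νi≉0 (supp p (x∉p-x S p))

  affineDependency : ∀ (q : Fin n → Point m) (S : Subset n) → suc m ℕ.< ∣ S ∣ →
    ∃ λ (ν : Fin n → Carrier) → Supported S ν × (∑ n ν ≈ 0#) × (∀ c → comb ν q c ≈ 0#) ×
      ∃ λ j → ¬ (ν j ≈ 0#)
  affineDependency {n} {m} q S 1+m<∣S∣ with dependency (suc m) homogenize S 1+m<∣S∣
    where
    homogenize : Fin n → Fin (suc m) → Carrier
    -- The constant coordinate forces the coefficients of a linear dependency to sum to 0.
    homogenize j zero = 1#
    homogenize j (suc c) = q j c
  ... | ν , supp , dep , ν≉0 = ν , supp ,
        trans (∑-cong λ j → sym (*-identityʳ (ν j))) (dep zero) , (λ c → dep (suc c)) , ν≉0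

  ∑-neg-coefficient : ∀ (ν : Fin n → Carrier) → ∑ n ν ≈ 0# → (∃ λ j → ¬ (ν j ≈ 0#)) → ∃ λ j → ν j <ᶠ 0#
  ∑-neg-coefficient {n} ν ∑≈0 (j , νj≉0) with any? (λ i → ν i <? 0#)
  ... | yes neg = neg
  ... | no ¬neg = contradiction (sym ∑≈0) λ 0≈∑ → irrefl 0≈∑
      (<-respˡ (∑-zero {n} λ _ → refl) (∑-mono-< nonneg j (nonneg∧≉0⇒pos (nonneg j) νj≉0)))
    where
    nonneg : Nonneg ν
    nonneg i = ≮⇒≥ λ νi<0 → ¬neg (i , νi<0)

  -- A dependency that lowers `h` is replaced by its negative. The coefficients sum to 0 without all
  -- vanishing, so one is negative; it will bound the length of the shift in `shrink`.
  ascendingDependency : ∀ (q : Fin n → Point m) (h : Fin n → Carrier) (S : Subset n) → suc m ℕ.< ∣ S ∣ →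
    ∃ λ (ν : Fin n → Carrier) → Supported S ν × (∑ n ν ≈ 0#) × (∀ c → comb ν q c ≈ 0#) ×
      0# ≤ᶠ ∑ n (λ j → ν j *ᶠ h j) × ∃ λ j → ν j <ᶠ 0#
  ascendingDependency {n} q h S 1+m<∣S∣ with affineDependency q S 1+m<∣S∣
  ... | ν , supp , ∑≈0 , dep , ν≉0@(i , νi≉0) with ∑ n (λ j → ν j *ᶠ h j) <? 0#
  ...   | no h≮0 = ν , supp , ∑≈0 , dep , ≮⇒≥ h≮0 , ∑-neg-coefficient ν ∑≈0 ν≉0
  ...   | yes h<0 = (λ j → - ν j) , (λ j j∉S → trans (-‿cong (supp j j∉S)) -0≈0) , ∑-ν≈0 ,
          (λ c → trans (∑-neg-comm (λ j → q j c)) (trans (-‿cong (dep c)) -0≈0)) ,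
          inj₁ (<-respʳ (sym (∑-neg-comm h)) (x<0⇒0<-x h<0)) ,
          ∑-neg-coefficient _ ∑-ν≈0 (i , λ -νi≈0 → νi≉0
              (trans (sym (-‿involutive (ν i))) (trans (-‿cong -νi≈0) -0≈0)))
    where
    -0≈0 : (- 0#) ≈ 0#
    -0≈0 = -0#≈0#
    ∑-neg-comm : ∀ (x : Fin n → Carrier) → ∑ n (λ j → (- ν j) *ᶠ x j) ≈ (- ∑ n (λ j → ν j *ᶠ x j))
    ∑-neg-comm x = trans (∑-cong {n} λ j → trans (sym (-‿distribˡ-* (ν j) (x j))) (sym (-1*x≈-x _)))
      (trans (∑-*ˡ {n} _ _) (-1*x≈-x _))
    ∑-ν≈0 : ∑ n (λ j → - ν j) ≈ 0#
    ∑-ν≈0 = trans (∑-cong {n} λ j → sym (-1*x≈-x (ν j))) (trans (∑-*ˡ {n} _ _)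
      (trans (*-congˡ ∑≈0) (zeroʳ _)))

  -- What a reduction of the support may do: the combined point and the total stay fixed, while `h`
  -- is an objective that may grow.
  record Reweighting {n m} (q : Fin n → Point m) (h : Fin n → Carrier)
                     (weight : Fin n → Carrier) (S : Subset n) : Set where
    field
      weight′ : Fin n → Carrier
      nonneg : Nonneg weight′
      support : Subset n
      supported : Supported support weight′
      support⊆ : support ⊆ S
      total : ∑ n weight′ ≈ ∑ n weight
      combines : ∀ c → comb weight′ q c ≈ comb weight q c
      ascends : ∑ n (λ j → weight j *ᶠ h j) ≤ᶠ ∑ n (λ j → weight′ j *ᶠ h j)

  Reweighting-trans : ∀ {q : Fin n → Point m} {h λ′ : Fin n → Carrier} {S : Subset n}
    (r : Reweighting q h λ′ S) → Reweighting q h (Reweighting.weight′ r) (Reweighting.support r) →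
    Reweighting q h λ′ S
  Reweighting-trans r r′ = record
    { weight′ = R′.weight′ ; nonneg = R′.nonneg ; support = R′.support ; supported = R′.supported
    ; support⊆ = R.support⊆ ∘ R′.support⊆ ; total = trans R′.total R.total
    ; combines = λ c → trans (R′.combines c) (R.combines c) ; ascends = ≤-trans R.ascends R′.ascends }
    where
    module R = Reweighting r
    module R′ = Reweighting r′

  -- Weight is shifted along the dependency until one of the weights vanishes.
  shrink : ∀ (q : Fin n → Point m) (h λ′ : Fin n → Carrier) (S : Subset n) → Nonneg λ′ → Supported S λ′ →
    suc m ℕ.< ∣ S ∣ → ∃ λ (r : Reweighting q h λ′ S) → ∣ Reweighting.support r ∣ ℕ.< ∣ S ∣
  shrink {n} {m} q h λ′ S nonneg supp 1+m<∣S∣ with ascendingDependency q h S 1+m<∣S∣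
  ... | ν , ν-supp , ∑ν≈0 , dep , asc , neg with argmin (λ j → ν j <? 0#) (λ j → λ′ j *ᶠ ((- ν j) ⁻¹)) neg
  ...   | i , νi<0 , min = record
          { weight′ = μ
          ; nonneg = μ-nonneg
          ; support = S - i
          ; supported = μ-supp
          ; support⊆ = x∈p-y⇒x∈p i
          ; total = trans (∑-+ λ′ (λ j → t *ᶠ ν j)) (trans
              (+-congˡ (trans (∑-*ˡ t ν) (trans (*-congˡ ∑ν≈0) (zeroʳ t)))) (+-identityʳ _))
          ; combines = λ c → trans (∑-linear λ′ ν (λ j → q j c) t)
              (trans (+-congˡ (trans (*-congˡ (dep c)) (zeroʳ t))) (+-identityʳ _))
          ; ascends = begin
              ∑ n (λ j → λ′ j *ᶠ h j)      ≈⟨ +-identityʳ _ ⟨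
              ∑ n (λ j → λ′ j *ᶠ h j) + 0# ≤⟨ +-monoʳ-≤ _ (*-nonneg 0≤t asc) ⟩
              ∑ n (λ j → λ′ j *ᶠ h j) + t *ᶠ ∑ n (λ j → ν j *ᶠ h j) ≈⟨ ∑-linear λ′ ν h t ⟨
              ∑ n (λ j → μ j *ᶠ h j) ∎
          } , x∈p⇒∣p-x∣<∣p∣ (Supported-pos ν-supp λ νi≈0 → irrefl νi≈0 νi<0)
    where
    ρ : Fin n → Carrier
    ρ j = λ′ j *ᶠ ((- ν j) ⁻¹)
    t : Carrier
    t = ρ i
    μ : Fin n → Carrier
    μ j = λ′ j + t *ᶠ ν j
    0<-ν⁻¹ : ∀ {j} → ν j <ᶠ 0# → 0# <ᶠ ((- ν j) ⁻¹)
    0<-ν⁻¹ νj<0 = inverse-pos (x<0⇒0<-x νj<0) (⁻¹-inverse (pos⇒≉0 (x<0⇒0<-x νj<0)))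
    0≤t : 0# ≤ᶠ t
    0≤t = *-nonneg (nonneg i) (inj₁ (0<-ν⁻¹ νi<0))
    ρ-cancel : ∀ {j} → ν j <ᶠ 0# → (ρ j *ᶠ (- ν j)) ≈ λ′ j
    ρ-cancel {j} νj<0 = trans (*-assoc (λ′ j) _ _) (trans (*-congˡ (trans (*-comm _ _)
      (⁻¹-inverse (pos⇒≉0 (x<0⇒0<-x νj<0))))) (*-identityʳ (λ′ j)))
    cancel : ∀ j → (t *ᶠ (- ν j) + t *ᶠ ν j) ≈ 0#
    cancel j = trans (sym (distribˡ t _ _)) (trans (*-congˡ (-‿inverseˡ (ν j))) (zeroʳ t))
    μ-nonneg : Nonneg μ
    μ-nonneg j with ν j <? 0#
    ... | no νj≮0 = begin
      0#              ≈⟨ +-identityˡ 0# ⟨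
      0# + 0#         ≤⟨ +-mono-≤ (nonneg j) (*-nonneg 0≤t (≮⇒≥ νj≮0)) ⟩
      λ′ j + t *ᶠ ν j  ∎
    ... | yes νj<0 = begin
      0#                           ≈⟨ cancel j ⟨
      t *ᶠ (- ν j) + t *ᶠ ν j        ≤⟨ +-monoˡ-≤ _ (*-monoʳ-≤ (inj₁ (x<0⇒0<-x νj<0)) (min j νj<0)) ⟩
      ρ j *ᶠ (- ν j) + t *ᶠ ν j      ≈⟨ +-congʳ (ρ-cancel νj<0) ⟩
      λ′ j + t *ᶠ ν j               ∎
    μ-supp : Supported (S - i) μ
    μ-supp j j∉ with x∉p-y⇒x∉p⊎x≡y j∉
    ... | inj₁ j∉S = Supported-lin t supp ν-supp j j∉S
    ... | inj₂ ≡.refl = trans (+-congʳ (sym (ρ-cancel νi<0))) (cancel i)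

  -- Applied in two ways: to full points, with the height among the coordinates, and to projected
  -- points, with the height as objective only. The second leaves one point fewer, few enough to lie
  -- on a common hyperplane.
  carathéodory : ∀ (q : Fin n → Point m) (h λ′ : Fin n → Carrier) (S : Subset n) → Nonneg λ′ → Supported S λ′ →
    ∃ λ (r : Reweighting q h λ′ S) → ∣ Reweighting.support r ∣ ℕ.≤ suc m
  carathéodory {n} {m} q h λ′ S nonneg supp = go ∣ S ∣ λ′ S nonneg supp ℕ.≤-refl
    where
    go : ∀ k (λ′ : Fin n → Carrier) (S : Subset n) → Nonneg λ′ → Supported S λ′ → ∣ S ∣ ℕ.≤ k →
      ∃ λ (r : Reweighting q h λ′ S) → ∣ Reweighting.support r ∣ ℕ.≤ suc m
    go k λ′ S nonneg supp ∣S∣≤k with ∣ S ∣ ℕ.≤? suc m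
    ... | yes small = record
          { weight′ = λ′ ; nonneg = nonneg ; support = S ; supported = supp ; support⊆ = λ x∈ → x∈
          ; total = refl ; combines = λ c → refl ; ascends = ≤-refl } , small
    go zero λ′ S nonneg supp ∣S∣≤0 | no large = contradiction (ℕ.≤-trans ∣S∣≤0 ℕ.z≤n) large
    go (suc k) λ′ S nonneg supp ∣S∣≤k | no large =
      Reweighting-trans r (proj₁ rest) , proj₂ rest
      where
      step = shrink q h λ′ S nonneg supp (ℕ.≰⇒> large)
      r = proj₁ step
      rest = go k (Reweighting.weight′ r) (Reweighting.support r) (Reweighting.nonneg r)
        (Reweighting.supported r) (ℕ.s≤s⁻¹ (ℕ.≤-trans (proj₂ step) ∣S∣≤k))

x∉p⇒∣p∪⁅x⁆∣≡1+∣p∣ : ∀ {n} {p : Subset n} {x} → x ∉ p → ∣ p ∪ ⁅ x ⁆ ∣ ≡ suc ∣ p ∣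
x∉p⇒∣p∪⁅x⁆∣≡1+∣p∣ {p = inside ∷ p} {zero} x∉p = contradiction here x∉p
x∉p⇒∣p∪⁅x⁆∣≡1+∣p∣ {suc n} {outside ∷ p} {zero} x∉p = ≡.cong (suc ∘ ∣_∣) (∪-identityʳ p)
x∉p⇒∣p∪⁅x⁆∣≡1+∣p∣ {p = inside ∷ p} {suc x} x∉p = ≡.cong suc (x∉p⇒∣p∪⁅x⁆∣≡1+∣p∣ (x∉p ∘ there))
x∉p⇒∣p∪⁅x⁆∣≡1+∣p∣ {p = outside ∷ p} {suc x} x∉p = x∉p⇒∣p∪⁅x⁆∣≡1+∣p∣ (x∉p ∘ there)

x∈p∪⁅y⁆⁻ : ∀ {n} {p : Subset n} {x y} → x ∈ p ∪ ⁅ y ⁆ → x ∈ p ⊎ x ≡ y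
x∈p∪⁅y⁆⁻ {p = p} {x} {y} x∈ with x∈p∪q⁻ p ⁅ y ⁆ x∈
... | inj₁ x∈p = inj₁ x∈p
... | inj₂ x∈⁅y⁆ = inj₂ (x∈⁅y⁆⇒x≡y y x∈⁅y⁆)

p∪⁅x⁆⊆ : ∀ {n} {p q : Subset n} {x} → p ⊆ q → x ∈ q → p ∪ ⁅ x ⁆ ⊆ q
p∪⁅x⁆⊆ {p = p} p⊆q x∈q y∈ with x∈p∪⁅y⁆⁻ {p = p} y∈
... | inj₁ y∈p = p⊆q y∈p
... | inj₂ ≡.refl = x∈q

x∈p∪⁅x⁆ : ∀ {n} (p : Subset n) x → x ∈ p ∪ ⁅ x ⁆
x∈p∪⁅x⁆ p x = x∈p∪q⁺ {p = p} (inj₂ (x∈⁅x⁆ x))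

x∈p─q⇒x∉q : ∀ {n} (p q : Subset n) {x} → x ∈ p ─ q → x ∉ q
x∈p─q⇒x∉q (_ ∷ p) (inside ∷ q) {zero} () here
x∈p─q⇒x∉q (_ ∷ p) (inside ∷ q) (there x∈p─q) (there x∈q) = x∈p─q⇒x∉q p q x∈p─q x∈q
x∈p─q⇒x∉q (_ ∷ p) (outside ∷ q) (there x∈p─q) (there x∈q) = x∈p─q⇒x∉q p q x∈p─q x∈q

-- Points under a convex hull

module Separation (F : OrderedField) where
  open OrderedField F hiding (zero; _-_) renaming (_*_ to _*ᶠ_)
  open Geometry F
  open OrderedFieldProperties F
  open Convexity F

  private
    variable
      n m e : ℕ

  ∑-affineFn : ∀ (μ : Fin n → Carrier) (v : Fin n → Point e) w w₀ →
    ∑ n (λ j → μ j *ᶠ affineFn w w₀ (v j)) ≈ (∑ e (λ c → w c *ᶠ comb μ v c) + w₀ *ᶠ ∑ n μ)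
  ∑-affineFn {n} {e} μ v w w₀ = begin-equality
    ∑ n (λ j → μ j *ᶠ affineFn w w₀ (v j))
      ≈⟨ ∑-cong {n} (λ j → trans (distribˡ (μ j) _ _) (+-cong (sym (∑-*ˡ {e} (μ j) _)) (*-comm (μ j) w₀))) ⟩
    ∑ n (λ j → ∑ e (λ c → μ j *ᶠ (w c *ᶠ v j c)) + w₀ *ᶠ μ j)
      ≈⟨ ∑-+ {n} _ _ ⟩
    ∑ n (λ j → ∑ e (λ c → μ j *ᶠ (w c *ᶠ v j c))) + ∑ n (λ j → w₀ *ᶠ μ j)
      ≈⟨ +-cong (∑-swap {n} {e} _) (∑-*ˡ w₀ μ) ⟩
    ∑ e (λ c → ∑ n (λ j → μ j *ᶠ (w c *ᶠ v j c))) + w₀ *ᶠ ∑ n μ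
      ≈⟨ +-congʳ (∑-cong {e} λ c → trans (∑-cong {n} λ j → x∙yz≈y∙xz (μ j) (w c) _) (∑-*ˡ {n} (w c) _)) ⟩
    ∑ e (λ c → w c *ᶠ comb μ v c) + w₀ *ᶠ ∑ n μ ∎

  affineFn-barycenter : ∀ (μ : Fin n → Carrier) (v : Fin n → Point e) {x : Point e} w w₀ →
    ∑ n μ ≈ 1# → (∀ c → comb μ v c ≈ x c) →
    ∑ n (λ j → μ j *ᶠ affineFn w w₀ (v j)) ≈ affineFn w w₀ x
  affineFn-barycenter {n} {e} μ v w w₀ ∑≈1 comb≈x = trans (∑-affineFn μ v w w₀)
    (+-cong (∑-cong {e} λ c → *-congˡ (comb≈x c)) (trans (*-congˡ ∑≈1) (*-identityʳ w₀)))

  affineFn-dependency : ∀ (ν : Fin n → Carrier) (v : Fin n → Point e) w w₀ →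
    ∑ n ν ≈ 0# → (∀ c → comb ν v c ≈ 0#) → ∑ n (λ j → ν j *ᶠ affineFn w w₀ (v j)) ≈ 0#
  affineFn-dependency {n} {e} ν v w w₀ ∑≈0 comb≈0 = trans (∑-affineFn ν v w w₀)
    (trans (+-cong (∑-zero {e} λ c → trans (*-congˡ (comb≈0 c)) (zeroʳ (w c))) (trans (*-congˡ ∑≈0) (zeroʳ w₀)))
      (+-identityˡ 0#))

  ∑-difference : ∀ (μ x y : Fin n → Carrier) →
    ∑ n (λ j → μ j *ᶠ (x j + (- y j))) ≈ (∑ n (λ j → μ j *ᶠ x j) + (- ∑ n (λ j → μ j *ᶠ y j)))
  ∑-difference {n} μ x y = trans (∑-cong {n} λ j → trans (distribˡ (μ j) _ _)
      (+-congˡ (trans (sym (-‿distribʳ-* (μ j) (y j))) (sym (-1*x≈-x _)))))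
    (trans (∑-+ {n} _ _) (+-congˡ (trans (∑-*ˡ {n} _ _) (-1*x≈-x _))))

  ∑-weighted-neg : ∀ {S : Subset n} {μ x : Fin n → Carrier} {i} → Nonneg μ → Supported S μ →
    (∀ {j} → j ∈ S → x j ≤ᶠ 0#) → 0# <ᶠ μ i → x i <ᶠ 0# → ∑ n (λ j → μ j *ᶠ x j) <ᶠ 0#
  ∑-weighted-neg {S = S} {μ} {x} {i} nonneg supp x≤0 0<μi xi<0 = ∑-neg (λ j → term j (j ∈? S)) i (*-pos-neg 0<μi xi<0)
    where
    term : ∀ j → Dec (j ∈ S) → (μ j *ᶠ x j) ≤ᶠ 0#
    term j (yes j∈S) = *-nonneg-nonpos (nonneg j) (x≤0 j∈S)
    term j (no j∉S) = inj₂ (trans (*-congʳ (supp j j∉S)) (zeroˡ (x j)))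

  Graph : (v : Fin n → Point e) (h : Fin n → Carrier) (S : Subset n) → Point e → Carrier → Set
  Graph v h S w w₀ = ∀ j → j ∈ S → affineFn w w₀ (v j) ≈ h j

  -- Deepness as it is used later, for dimension d = e + 1: the hyperplane is available also when
  -- fewer than d points are prescribed. Points are indices with projection `v` and height `h`, so
  -- negating `h` turns "below" into "above".
  UnderHyperplanes : (v : Fin n → Point e) (h : Fin n → Carrier) (B A : Subset n) → Set
  UnderHyperplanes {n} {e} v h B A = ∀ (S : Subset n) → S ⊆ A → ∣ S ∣ ℕ.≤ suc e →
    ∃ λ w → ∃ λ w₀ → Graph v h S w w₀ × (∀ b → b ∈ B → h b <ᶠ affineFn w w₀ (v b))

  -- Membership in conv S extended by the downward vertical ray: the weights describe a point of
  -- conv S vertically above `a` or equal to it.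
  record UnderHull (v : Fin n → Point e) (h : Fin n → Carrier) (S : Subset n) (a : Fin n) : Set where
    field
      weight : Fin n → Carrier
      nonneg : Nonneg weight
      supported : Supported S weight
      total : ∑ n weight ≈ 1#
      combines : ∀ c → comb weight v c ≈ v a c
      height : h a ≤ᶠ ∑ n (λ j → weight j *ᶠ h j)

  UnderHull-⊆ : ∀ {v : Fin n → Point e} {h} {S T : Subset n} {a} → S ⊆ T → UnderHull v h S a → UnderHull v h T a
  UnderHull-⊆ S⊆T u = record
    { weight = U.weight ; nonneg = U.nonneg ; supported = λ j j∉T → U.supported j (j∉T ∘ S⊆T)
    ; total = U.total ; combines = U.combines ; height = U.height }
    where module U = UnderHull u

  module _ (v : Fin n → Point e) (h : Fin n → Carrier) (A B : Subset n)
           (B<A : UnderHyperplanes v h B A) {S : Subset n} {a : Fin n} {μ : Fin n → Carrier}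
           (∣S∣≤2+e : ∣ S ∣ ℕ.≤ suc (suc e)) (S⊆A∪B : ∀ {j} → j ∈ S → j ∈ A ⊎ j ∈ B)
           (a∈A : a ∈ A) (a∉S : a ∉ S) (nonneg : Nonneg μ) (supported : Supported S μ)
           (total : ∑ n μ ≈ 1#) (combines : ∀ c → comb μ v c ≈ v a c)
           (height : ∑ n (λ j → μ j *ᶠ h j) ≈ h a)
           {y : Fin n} (y∈B : y ∈ B) (y∉A : y ∉ A) (0<μy : 0# <ᶠ μ y) where

    private
      X : Subset n
      X = S ∩ A

      y∈S : y ∈ S
      y∈S = Supported-pos supported (pos⇒≉0 0<μy)

      ∣X∣≤1+e : ∣ X ∣ ℕ.≤ suc e
      ∣X∣≤1+e = ℕ.≤-trans (p⊆q⇒∣p∣≤∣q∣ X⊆S-y) (ℕ.s≤s⁻¹ (ℕ.≤-trans (x∈p⇒∣p-x∣<∣p∣ y∈S) ∣S∣≤2+e))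
        where
        X⊆S-y : X ⊆ S - y
        X⊆S-y x∈X = x∈p∧x≢y⇒x∈p-y (proj₁ (x∈p∩q⁻ S A x∈X)) λ { ≡.refl → y∉A (proj₂ (x∈p∩q⁻ S A x∈X)) }

      X⊆A : X ⊆ A
      X⊆A = p∩q⊆q S A

      a∉X : a ∉ X
      a∉X = a∉S ∘ p∩q⊆p S A

      excess : Point e → Carrier → Fin n → Carrier
      excess w w₀ j = h j + (- affineFn w w₀ (v j))

      ∑-excess : ∀ w w₀ → ∑ n (λ j → μ j *ᶠ excess w w₀ j) ≈ excess w w₀ a
      ∑-excess w w₀ = trans (∑-difference μ h _)
        (+-cong height (-‿cong (affineFn-barycenter μ v w w₀ total combines)))

      excess-graph : ∀ {T w w₀ j} → Graph v h T w w₀ → j ∈ T → excess w w₀ j ≈ 0#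
      excess-graph graph j∈T = trans (+-congˡ (-‿cong (graph _ j∈T))) (-‿inverseʳ _)

      excess-under : ∀ {w w₀ j} → h j <ᶠ affineFn w w₀ (v j) → excess w w₀ j <ᶠ 0#
      excess-under h<g = <-respʳ (-‿inverseʳ _) (<-+-mono _ h<g)

      -- `excess` is affine, so its value at `a` is the weighted average of its values on `S`; none
      -- of these is positive and the one at `y` is negative.
      excess<0 : ∀ w w₀ → (∀ b → b ∈ B → h b <ᶠ affineFn w w₀ (v b)) →
        (∀ {x} → x ∈ X → excess w w₀ x ≤ᶠ 0#) → excess w w₀ a <ᶠ 0#
      excess<0 w w₀ under X≤0 = <-respˡ (∑-excess w w₀)
        (∑-weighted-neg nonneg supported S≤0 0<μy (excess-under (under y y∈B)))
        where
        S≤0 : ∀ {j} → j ∈ S → excess w w₀ j ≤ᶠ 0#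
        S≤0 {j} j∈S with S⊆A∪B j∈S
        ... | inj₁ j∈A = X≤0 (x∈p∩q⁺ (j∈S , j∈A))
        ... | inj₂ j∈B = inj₁ (excess-under (under j j∈B))

      -- With at most e points in `X`, one hyperplane takes in both `X` and `a` and has `B` strictly
      -- below; averaging then puts `a` strictly below a hyperplane through `a`.
      e<∣X∣ : e ℕ.< ∣ X ∣
      e<∣X∣ with e ℕ.<? ∣ X ∣
      ... | yes e<∣X∣ = e<∣X∣
      ... | no e≮∣X∣ with B<A (X ∪ ⁅ a ⁆) (p∪⁅x⁆⊆ X⊆A a∈A)
                          (ℕ.≤-trans (ℕ.≤-reflexive (x∉p⇒∣p∪⁅x⁆∣≡1+∣p∣ a∉X)) (ℕ.s≤s (ℕ.≮⇒≥ e≮∣X∣)))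
      ...   | w , w₀ , graph , under = contradiction
              (excess<0 w w₀ under λ x∈X → inj₂ (excess-graph graph (p⊆p∪q ⁅ a ⁆ x∈X)))
              (irrefl (excess-graph graph (x∈p∪⁅x⁆ X a)))

      facet : ∃ λ w → ∃ λ w₀ → Graph v h X w w₀ × (∀ b → b ∈ B → h b <ᶠ affineFn w w₀ (v b))
      facet = B<A X X⊆A ∣X∣≤1+e

      w₁ = proj₁ facet
      w₁₀ = proj₁ (proj₂ facet)

      g₁ : Fin n → Carrier
      g₁ j = affineFn w₁ w₁₀ (v j)

      g₁-graph : Graph v h X w₁ w₁₀
      g₁-graph = proj₁ (proj₂ (proj₂ facet))

      a-under-g₁ : h a <ᶠ g₁ a
      a-under-g₁ = subst-< (excess<0 w₁ w₁₀ (proj₂ (proj₂ (proj₂ facet)))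
          (λ x∈X → inj₂ (excess-graph g₁-graph x∈X)))
        where
        subst-< : (h a + (- g₁ a)) <ᶠ 0# → h a <ᶠ g₁ a
        subst-< lt = begin-strict
          h a                     ≈⟨ trans (+-assoc _ _ _) (trans (+-congˡ (-‿inverseˡ _)) (+-identityʳ _)) ⟨
          (h a + (- g₁ a)) + g₁ a <⟨ <-+-mono _ lt ⟩
          0# + g₁ a               ≈⟨ +-identityˡ _ ⟩
          g₁ a                    ∎

      -- g₁ minus the affine function of the hyperplane that trades the vertex x for a:
      -- it vanishes on the rest of X and is positive both at x and at a.
      record Exchange (x : Fin n) : Set where
        field
          w : Point e
          w₀ : Carrier
        D : Fin n → Carrier
        D j = g₁ j + (- affineFn w w₀ (v j))
        field
          vanishes : ∀ {j} → j ∈ X → j ≢ x → D j ≈ 0#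
          pos-x : 0# <ᶠ D x
          pos-a : 0# <ᶠ D a

      -- If `x` were not strictly above the hyperplane through `a` and the rest of `X`, no point of
      -- `S` would be above it while `y` is below, so `a` could not lie on it. Positivity at `a` is
      -- `a-under-g₁`, as the new hyperplane passes through `a`.
      exchange : ∀ {x} → x ∈ X → Exchange x
      exchange {x} x∈X with B<A ((X - x) ∪ ⁅ a ⁆) (p∪⁅x⁆⊆ (X⊆A ∘ x∈p-y⇒x∈p x) a∈A)
        (ℕ.≤-trans (ℕ.≤-reflexive (x∉p⇒∣p∪⁅x⁆∣≡1+∣p∣ (a∉X ∘ x∈p-y⇒x∈p x)))
          (ℕ.≤-trans (x∈p⇒∣p-x∣<∣p∣ x∈X) ∣X∣≤1+e))
      ... | w , w₀ , graph , under = record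
            { w = w ; w₀ = w₀
            ; vanishes = λ j∈X j≢x → trans (+-congʳ (g₁-graph _ j∈X))
                (excess-graph graph (p⊆p∪q ⁅ a ⁆ (x∈p∧x≢y⇒x∈p-y j∈X j≢x)))
            ; pos-x = <-respʳ (+-congʳ (sym (g₁-graph x x∈X))) excess-x
            ; pos-a = <-respʳ (+-congˡ (-‿cong (sym (graph a (x∈p∪⁅x⁆ (X - x) a))))) (x<y⇒0<y-x a-under-g₁) }
        where
        excess-x : 0# <ᶠ excess w w₀ x
        excess-x with 0# <? excess w w₀ x
        ... | yes 0<x = 0<x
        ... | no 0≮x = contradiction
          (excess<0 w w₀ under λ {x′} x′∈X → others x′∈X (x′ Fin.≟ x))
          (irrefl (excess-graph graph (x∈p∪⁅x⁆ (X - x) a)))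
          where
          others : ∀ {x′} → x′ ∈ X → Dec (x′ ≡ x) → excess w w₀ x′ ≤ᶠ 0#
          others x′∈X (yes ≡.refl) = ≮⇒≥ 0≮x
          others x′∈X (no x′≢x) = inj₂ (excess-graph graph (p⊆p∪q ⁅ a ⁆ (x∈p∧x≢y⇒x∈p-y x′∈X x′≢x)))

      -- `D` is a positive multiple of the barycentric coordinate belonging to `x` in the projected
      -- simplex, so it reads off a single weight.
      ∑-D : ∀ {τ : Fin n → Carrier} {x} (x∈X : x ∈ X) → Supported X τ →
        ∑ n (λ j → τ j *ᶠ Exchange.D (exchange x∈X) j) ≈ (τ x *ᶠ Exchange.D (exchange x∈X) x)
      ∑-D {τ} {x} x∈X supp = ∑-single x λ j j≢x → term j j≢x (j ∈? X)
        where
        term : ∀ j → j ≢ x → Dec (j ∈ X) → (τ j *ᶠ Exchange.D (exchange x∈X) j) ≈ 0#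
        term j j≢x (yes j∈X) = trans (*-congˡ (Exchange.vanishes (exchange x∈X) j∈X j≢x)) (zeroʳ (τ j))
        term j j≢x (no j∉X) = trans (*-congʳ (supp j j∉X)) (zeroˡ _)

    -- In dimension e the projections of `a` and of the e + 1 points of `X` are affinely dependent.
    -- The dependency is solved for `a`, the signs of the solution come from `Exchange`, and the
    -- height comparison is `a-under-g₁`, because `g₁` interpolates `h` on `X`.
    facet-underHull : UnderHull v h X a
    facet-underHull with affineDependency v (X ∪ ⁅ a ⁆)
      (ℕ.≤-trans (ℕ.s≤s e<∣X∣) (ℕ.≤-reflexive (≡.sym (x∉p⇒∣p∪⁅x⁆∣≡1+∣p∣ a∉X))))
    ... | ν , ν-supp , ∑ν≈0 , dep , i , νi≉0 = record
          { weight = τ ; nonneg = τ-nonneg ; supported = τ-supp ; total = τ-total ; combines = τ-combines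
          ; height = inj₁ (<-respʳ (trans (sym (affineFn-barycenter τ v w₁ w₁₀ τ-total τ-combines))
              (Supported-∑-cong τ-supp g₁-graph)) a-under-g₁) }
      where
      -- The projections of `X` alone are affinely independent, since each `Exchange` function
      -- isolates one coefficient.
      νa≉0 : ¬ (ν a ≈ 0#)
      νa≉0 νa≈0 = νi≉0 (ν≈0 i (i ∈? X))
        where
        X-supp : Supported X ν
        X-supp j j∉X with j Fin.≟ a
        ... | yes ≡.refl = νa≈0
        ... | no j≢a = ν-supp j λ j∈ → case (x∈p∪⁅y⁆⁻ {p = X} j∈)
          where
          case : ¬ (j ∈ X ⊎ j ≡ a)
          case (inj₁ j∈X) = j∉X j∈X
          case (inj₂ j≡a) = j≢a j≡a
        ν≈0 : ∀ j → Dec (j ∈ X) → ν j ≈ 0#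
        ν≈0 j (no j∉X) = X-supp j j∉X
        ν≈0 j (yes j∈X) = *-cancel-0 (pos⇒≉0 (Exchange.pos-x (exchange j∈X)))
          (trans (sym (∑-D j∈X X-supp)) (trans (∑-difference ν g₁ _)
            (trans (+-cong (affineFn-dependency ν v w₁ w₁₀ ∑ν≈0 dep)
                           (-‿cong (affineFn-dependency ν v (Exchange.w (exchange j∈X))
                               (Exchange.w₀ (exchange j∈X)) ∑ν≈0 dep)))
              (-‿inverseʳ 0#))))
      κ : Carrier
      -- The scaling for which the weight of `a` in `τ` cancels.
      κ = (- ν a) ⁻¹
      τ : Fin n → Carrier
      τ j = δ a j + κ *ᶠ ν j
      κνa : (1# + κ *ᶠ ν a) ≈ 0#
      κνa = trans (+-congʳ (sym (trans (*-comm κ _) (⁻¹-inverse λ -νa≈0 → νa≉0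
          (trans (sym (-‿involutive (ν a))) (trans (-‿cong -νa≈0) -0#≈0#))))))
        (trans (sym (distribˡ κ _ _)) (trans (*-congˡ (-‿inverseˡ (ν a))) (zeroʳ κ)))
      τ-supp : Supported X τ
      τ-supp j j∉X with j Fin.≟ a
      ... | yes ≡.refl = trans (+-congʳ (δ-refl a)) κνa
      ... | no j≢a = trans (+-cong (δ-≢ {i = a} {j} j≢a)
          (trans (*-congˡ (ν-supp j λ j∈ → case (x∈p∪⁅y⁆⁻ {p = X} j∈))) (zeroʳ κ)))
                       (+-identityˡ 0#)
        where
        case : ¬ (j ∈ X ⊎ j ≡ a)
        case (inj₁ j∈X) = j∉X j∈X
        case (inj₂ j≡a) = j≢a j≡a
      τ-total : ∑ n τ ≈ 1#
      τ-total = trans (∑-+ (δ a) (λ j → κ *ᶠ ν j)) (trans (+-cong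
        (trans (∑-cong {n} λ j → sym (*-identityʳ (δ a j))) (∑-δ a (λ _ → 1#)))
        (trans (∑-*ˡ κ ν) (trans (*-congˡ ∑ν≈0) (zeroʳ κ)))) (+-identityʳ 1#))
      τ-combines : ∀ c → comb τ v c ≈ v a c
      τ-combines c = trans (∑-linear (δ a) ν (λ j → v j c) κ)
        (trans (+-cong (∑-δ a (λ j → v j c)) (trans (*-congˡ (dep c)) (zeroʳ κ))) (+-identityʳ _))
      τ-nonneg : Nonneg τ
      τ-nonneg j with j ∈? X
      ... | no j∉X = inj₂ (sym (τ-supp j j∉X))
      -- Averaging `D` with the weights `τ` gives its value at `a`; hence τ j · D j = D a is
      -- positive, and so is τ j.
      ... | yes j∈X = inj₁ (pos-cancelʳ (Exchange.pos-x s) (<-respʳ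
              (trans (sym (trans (∑-difference τ g₁ _) (+-cong
                (affineFn-barycenter τ v w₁ w₁₀ τ-total τ-combines)
                (-‿cong (affineFn-barycenter τ v (Exchange.w s) (Exchange.w₀ s) τ-total τ-combines)))))
                (∑-D j∈X τ-supp)) (Exchange.pos-a s)))
        where
        s = exchange j∈X

  -- Carathéodory leaves at most e + 2 points. If some point of `B` keeps a nonzero weight,
  -- `facet-underHull` applies; otherwise all the weight is on `A` and the height is attained
  -- exactly.
  underHull : ∀ (v : Fin n → Point e) (h : Fin n → Carrier) (A B : Subset n) →
    UnderHyperplanes v h B A → (∀ {j} → j ∈ A → j ∉ B) → ∀ {S a μ} →
    (∀ {j} → j ∈ S → j ∈ A ⊎ j ∈ B) → a ∈ A → a ∉ S → Nonneg μ → Supported S μ →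
    ∑ n μ ≈ 1# → (∀ c → comb μ v c ≈ v a c) → ∑ n (λ j → μ j *ᶠ h j) ≈ h a →
    UnderHull v h (S ∩ A) a
  underHull {n} {e} v h A B B<A disjoint {S} {a} {μ} S⊆A∪B a∈A a∉S nonneg supported total combines height =
    conclude (any? λ j → (j ∈? B) ×-dec ¬? (R.weight′ j ≟ 0#))
    where
    q : Fin n → Point (suc e)
    -- With the height as a coordinate, the reduction preserves it exactly.
    q j zero = h j
    q j (suc c) = v j c
    reduced = carathéodory q h μ S nonneg supported
    module R = Reweighting (proj₁ reduced)
    total′ : ∑ n R.weight′ ≈ 1#
    total′ = trans R.total total
    combines′ : ∀ c → comb R.weight′ v c ≈ v a c
    combines′ c = trans (R.combines (suc c)) (combines c)
    height′ : ∑ n (λ j → R.weight′ j *ᶠ h j) ≈ h a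
    height′ = trans (R.combines zero) height
    conclude : Dec (∃ λ j → (j ∈ B) × ¬ (R.weight′ j ≈ 0#)) → UnderHull v h (S ∩ A) a
    conclude (yes (y , y∈B , μy≉0)) = UnderHull-⊆ (λ {x} x∈ → x∈p∩q⁺
          (R.support⊆ (p∩q⊆p R.support A x∈) , p∩q⊆q R.support A x∈))
      (facet-underHull v h A B B<A (proj₂ reduced) (S⊆A∪B ∘ R.support⊆) a∈A (a∉S ∘ R.support⊆)
        R.nonneg R.supported total′ combines′ height′ y∈B (λ y∈A → disjoint y∈A y∈B)
        (nonneg∧≉0⇒pos (R.nonneg y) μy≉0))
    conclude (no none) = record
      { weight = R.weight′ ; nonneg = R.nonneg ; supported = supp ; total = total′ ; combines = combines′
      ; height = inj₂ (sym height′) }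
      where
      supp : Supported (S ∩ A) R.weight′
      supp j j∉ with R.weight′ j ≟ 0#
      ... | yes μj≈0 = μj≈0
      ... | no μj≉0 with R.support⊆ (Supported-pos R.supported μj≉0)
      ...   | j∈S with S⊆A∪B j∈S
      ...     | inj₁ j∈A = contradiction (x∈p∩q⁺ (j∈S , j∈A)) j∉
      ...     | inj₂ j∈B = contradiction (j , j∈B , μj≉0) none

  -- Reducing in the projected space leaves at most e + 1 points without lowering the height. The
  -- hyperplane supplied for them passes strictly below `a`, yet its height over `a` is that of the
  -- combination, which is not below `a`.
  over⇒¬underHull : ∀ (v : Fin n → Point e) (h : Fin n → Carrier) (A B : Subset n) →
    UnderHyperplanes v (λ j → - h j) A B → ∀ {S a} → S ⊆ B → a ∈ A → ¬ UnderHull v h S a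
  over⇒¬underHull {n} {e} v h A B A>B {S} {a} S⊆B a∈A u
    with A>B R.support (S⊆B ∘ R.support⊆) (proj₂ reduced)
    where
    module U = UnderHull u
    reduced = carathéodory v h U.weight S U.nonneg U.supported
    module R = Reweighting (proj₁ reduced)
  ... | w , w₀ , graph , over = <⇒≱ (over a a∈A) (begin
        affineFn w w₀ (v a)                           ≈⟨ affineFn-barycenter R.weight′ v w w₀ (trans R.total U.total)
                                                           (λ c → trans (R.combines c) (U.combines c)) ⟨
        ∑ n (λ j → R.weight′ j *ᶠ affineFn w w₀ (v j)) ≈⟨ Supported-∑-cong R.supported graph ⟩
        ∑ n (λ j → R.weight′ j *ᶠ (- h j))             ≈⟨ ∑-*-neg R.weight′ h ⟩
        - ∑ n (λ j → R.weight′ j *ᶠ h j)               ≤⟨ neg-anti (≤-trans U.height R.ascends) ⟩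
        - h a                                         ∎)
    where
    module U = UnderHull u
    reduced = carathéodory v h U.weight S U.nonneg U.supported
    module R = Reweighting (proj₁ reduced)
    neg-anti : ∀ {x y} → x ≤ᶠ y → (- y) ≤ᶠ (- x)
    neg-anti (inj₁ x<y) = inj₁ (-‿anti-< x<y)
    neg-anti (inj₂ x≈y) = inj₂ (-‿cong (sym x≈y))

-- Subsets, sublists and residue classes

∣p∣<∣q∣⇒∃x∈q∖p : ∀ {n} (p q : Subset n) → ∣ p ∣ ℕ.< ∣ q ∣ → ∃ λ x → x ∈ q × x ∉ p
∣p∣<∣q∣⇒∃x∈q∖p p q ∣p∣<∣q∣ with any? (λ x → (x ∈? q) ×-dec ¬? (x ∈? p))
... | yes found = found
... | no none = contradiction (p⊆q⇒∣p∣≤∣q∣ λ {x} x∈q → decidable-stable (x ∈? p) λ x∉p → none (x , x∈q , x∉p))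
                  (ℕ.<⇒≱ ∣p∣<∣q∣)

abstract
  subset-between : ∀ {n} k {p q : Subset n} → p ⊆ q → ∣ p ∣ ℕ.≤ k → k ℕ.≤ ∣ q ∣ →
    ∃ λ r → p ⊆ r × r ⊆ q × ∣ r ∣ ≡ k
  subset-between k {p} {q} p⊆q ∣p∣≤k k≤∣q∣ = go (k ℕ.∸ ∣ p ∣) p p⊆q (ℕ.m∸n+n≡m ∣p∣≤k)
    where
    go : ∀ f p → p ⊆ q → f ℕ.+ ∣ p ∣ ≡ k → ∃ λ r → p ⊆ r × r ⊆ q × ∣ r ∣ ≡ k
    go zero p p⊆q ∣p∣≡k = p , (λ x∈p → x∈p) , p⊆q , ∣p∣≡k
    go (suc f) p p⊆q 1+f+∣p∣≡k with ∣p∣<∣q∣⇒∃x∈q∖p p q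
      (ℕ.≤-trans (ℕ.s≤s (ℕ.m≤n+m ∣ p ∣ f)) (ℕ.≤-trans (ℕ.≤-reflexive 1+f+∣p∣≡k) k≤∣q∣))
    ... | x , x∈q , x∉p with go f (p ∪ ⁅ x ⁆) (p∪⁅x⁆⊆ p⊆q x∈q)
      (≡.trans (≡.cong (f ℕ.+_) (x∉p⇒∣p∪⁅x⁆∣≡1+∣p∣ x∉p)) (≡.trans (ℕ.+-suc f _) 1+f+∣p∣≡k))
    ...   | r , p∪x⊆r , r⊆q , ∣r∣≡k = r , p∪x⊆r ∘ p⊆p∪q ⁅ x ⁆ , r⊆q , ∣r∣≡k

element : ∀ {n} (p : Subset n) → Fin ∣ p ∣ → Fin n
element (inside ∷ p) zero = zero
element (inside ∷ p) (suc i) = suc (element p i)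
element (outside ∷ p) i = suc (element p i)

element-injective : ∀ {n} (p : Subset n) {i j} → element p i ≡ element p j → i ≡ j
element-injective (inside ∷ p) {zero} {zero} _ = ≡.refl
element-injective (inside ∷ p) {suc i} {suc j} eq = ≡.cong suc (element-injective p (suc-injective eq))
element-injective (outside ∷ p) eq = element-injective p (suc-injective eq)

element-∈ : ∀ {n} (p : Subset n) i → element p i ∈ p
element-∈ (inside ∷ p) zero = here
element-∈ (inside ∷ p) (suc i) = there (element-∈ p i)
element-∈ (outside ∷ p) i = there (element-∈ p i)

element-surjective : ∀ {n} {p : Subset n} {x} → x ∈ p → ∃ λ i → element p i ≡ x
element-surjective here = zero , ≡.refl
element-surjective {p = inside ∷ p} (there x∈p) with element-surjective x∈p
... | i , ≡.refl = suc i , ≡.refl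
element-surjective {p = outside ∷ p} (there x∈p) with element-surjective x∈p
... | i , ≡.refl = i , ≡.refl

abstract
  enumerate : ∀ {n k} (p : Subset n) → ∣ p ∣ ≡ k → ∃ λ (t : Fin k → Fin n) →
    Injective _≡_ _≡_ t × (∀ i → t i ∈ p) × (∀ {x} → x ∈ p → ∃ λ i → t i ≡ x)
  enumerate p ≡.refl = element p , element-injective p , element-∈ p , element-surjective

injection⇒≤∣p∣ : ∀ {n m} {p : Subset n} (t : Fin m → Fin n) → Injective _≡_ _≡_ t → (∀ i → t i ∈ p) → m ℕ.≤ ∣ p ∣
injection⇒≤∣p∣ {m = zero} t inj t∈p = ℕ.z≤n
injection⇒≤∣p∣ {m = suc m} {p} t inj t∈p = ℕ.≤-trans (ℕ.s≤s (injection⇒≤∣p∣ (t ∘ suc) (suc-injective ∘ inj)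
  λ i → x∈p∧x≢y⇒x∈p-y (t∈p (suc i)) λ eq → 0≢1+n (inj (≡.sym eq)))) (x∈p⇒∣p-x∣<∣p∣ (t∈p zero))

module _ {A B : Set} {R : A → B → Set} where

  -- `R` is kept general because not only classes of `H` but also the lists of their projected
  -- points are embedded into `H`, with the graph of the projection as `R`.
  embed : ∀ {xs ys} → Sublist R xs ys → Fin (length xs) → Fin (length ys)
  embed (y ∷ʳ σ) i = suc (embed σ i)
  embed (r ∷ σ) zero = zero
  embed (r ∷ σ) (suc i) = suc (embed σ i)

  embed-injective : ∀ {xs ys} (σ : Sublist R xs ys) {i j} → embed σ i ≡ embed σ j → i ≡ j
  embed-injective (y ∷ʳ σ) eq = embed-injective σ (suc-injective eq)
  embed-injective (r ∷ σ) {zero} {zero} eq = ≡.refl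
  embed-injective (r ∷ σ) {suc i} {suc j} eq = ≡.cong suc (embed-injective σ (suc-injective eq))

  lookup-embed : ∀ {xs ys} (σ : Sublist R xs ys) i → R (List.lookup xs i) (List.lookup ys (embed σ i))
  lookup-embed (y ∷ʳ σ) i = lookup-embed σ i
  lookup-embed (r ∷ σ) zero = r
  lookup-embed (r ∷ σ) (suc i) = lookup-embed σ i

  image : ∀ {xs ys} → Sublist R xs ys → Subset (length xs) → Subset (length ys)
  image [] S = []
  image (y ∷ʳ σ) S = outside ∷ image σ S
  image (r ∷ σ) (s ∷ S) = s ∷ image σ S

  ∣image∣ : ∀ {xs ys} (σ : Sublist R xs ys) S → ∣ image σ S ∣ ≡ ∣ S ∣
  ∣image∣ [] [] = ≡.refl
  ∣image∣ (y ∷ʳ σ) S = ∣image∣ σ S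
  ∣image∣ (r ∷ σ) (inside ∷ S) = ≡.cong suc (∣image∣ σ S)
  ∣image∣ (r ∷ σ) (outside ∷ S) = ∣image∣ σ S

  ∈-image⁺ : ∀ {xs ys} (σ : Sublist R xs ys) {S i} → i ∈ S → embed σ i ∈ image σ S
  ∈-image⁺ (y ∷ʳ σ) i∈S = there (∈-image⁺ σ i∈S)
  ∈-image⁺ (r ∷ σ) here = here
  ∈-image⁺ (r ∷ σ) (there i∈S) = there (∈-image⁺ σ i∈S)

  ∈-image⁻ : ∀ {xs ys} (σ : Sublist R xs ys) {S j} → j ∈ image σ S → ∃ λ i → i ∈ S × embed σ i ≡ j
  ∈-image⁻ (y ∷ʳ σ) (there j∈) with ∈-image⁻ σ j∈
  ... | i , i∈S , ≡.refl = i , i∈S , ≡.refl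
  ∈-image⁻ (r ∷ σ) {s ∷ S} here = zero , here , ≡.refl
  ∈-image⁻ (r ∷ σ) {s ∷ S} (there j∈) with ∈-image⁻ σ j∈
  ... | i , i∈S , ≡.refl = suc i , there i∈S , ≡.refl

  ∈-image-embed⁻ : ∀ {xs ys} (σ : Sublist R xs ys) {S i} → embed σ i ∈ image σ S → i ∈ S
  ∈-image-embed⁻ σ {S} i∈ with ∈-image⁻ σ i∈
  ... | i′ , i′∈S , eq = ≡.subst (_∈ S) (embed-injective σ eq) i′∈S

mod-class : ∀ p .{{_ : NonZero p}} {n} → Fin n → Fin p
mod-class p j = toℕ j mod p

-- The index set in `H` of the list `unionClasses p J H`; it lets all classes be compared as subsets
-- of one `Fin (length H)`.
classes : ∀ p .{{_ : NonZero p}} n → Subset p → Subset n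
classes p n J = tabulate λ j → Vec.lookup J (mod-class p j)

∈-classes⁺ : ∀ p .{{_ : NonZero p}} {n} {J : Subset p} {j : Fin n} → mod-class p j ∈ J → j ∈ classes p n J
∈-classes⁺ p {J = J} {j} j∈J = Vec.lookup⇒[]= j _ (≡.trans (Vec.lookup∘tabulate _ j) (Vec.[]=⇒lookup j∈J))

∈-classes⁻ : ∀ p .{{_ : NonZero p}} {n} {J : Subset p} {j : Fin n} → j ∈ classes p n J → mod-class p j ∈ J
∈-classes⁻ p {J = J} {j} j∈ = Vec.lookup⇒[]= _ J (≡.trans (≡.sym (Vec.lookup∘tabulate _ j)) (Vec.[]=⇒lookup j∈))

-- Deepness of lists turned into deepness of index sets

module Selection (F : OrderedField) where
  open OrderedField F hiding (zero; _-_) renaming (_*_ to _*ᶠ_)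
  open Geometry F
  open OrderedFieldProperties F
  open Convexity F
  open Separation F

  private
    variable
      n m e : ℕ

  select-⊑ : ∀ {A : Set} (P : ℕ → Bool) k (xs : List A) → selectIdx P k xs ⊑ xs
  select-⊑ P k [] = []
  select-⊑ P k (x ∷ xs) with P k
  ... | true = ≡.refl ∷ select-⊑ P (suc k) xs
  ... | false = x ∷ʳ select-⊑ P (suc k) xs

  select-surjective : ∀ {A : Set} (P : ℕ → Bool) k (xs : List A) j → P (k ℕ.+ toℕ j) ≡ true →
    ∃ λ i → embed (select-⊑ P k xs) i ≡ j
  select-surjective P k (x ∷ xs) zero Pj with P k in Pk
  ... | true = zero , ≡.refl
  ... | false = contradiction (≡.trans (≡.sym Pk) (≡.trans (≡.cong P (≡.sym (ℕ.+-identityʳ k))) Pj)) λ ()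
  select-surjective P k (x ∷ xs) (suc j) Pj
    with P k | select-surjective P (suc k) xs j (≡.trans (≡.cong P (≡.sym (ℕ.+-suc k _))) Pj)
  ... | true | i , ≡.refl = suc i , ≡.refl
  ... | false | i , ≡.refl = i , ≡.refl

  select-true : ∀ {A : Set} (P : ℕ → Bool) k (xs : List A) i → P (k ℕ.+ toℕ (embed (select-⊑ P k xs) i)) ≡ true
  select-true P k (x ∷ xs) i with P k in Pk
  select-true P k (x ∷ xs) zero | true = ≡.trans (≡.cong P (ℕ.+-identityʳ k)) Pk
  select-true P k (x ∷ xs) (suc i) | true = ≡.trans (≡.cong P (ℕ.+-suc k _)) (select-true P (suc k) xs i)
  select-true P k (x ∷ xs) i | false = ≡.trans (≡.cong P (ℕ.+-suc k _)) (select-true P (suc k) xs i)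

  union-⊑ : ∀ {A : Set} p .{{_ : NonZero p}} (J : Subset p) (H : List A) → unionClasses p J H ⊑ H
  union-⊑ p J H = select-⊑ _ 0 H

  union-surjective : ∀ {A : Set} p .{{_ : NonZero p}} (J : Subset p) (H : List A) {j} →
    j ∈ classes p (length H) J → ∃ λ i → embed (union-⊑ p J H) i ≡ j
  union-surjective p J H {j} j∈ = select-surjective _ 0 H j (Vec.[]=⇒lookup (∈-classes⁻ p {J = J} {j} j∈))

  union-class : ∀ {A : Set} p .{{_ : NonZero p}} (J : Subset p) (H : List A) i →
    mod-class p (embed (union-⊑ p J H) i) ∈ J
  union-class p J H i = Vec.lookup⇒[]= _ J (select-true _ 0 H i)

  ∑-embed : ∀ {A B : Set} {R : A → B → Set} {xs ys} (σ : Sublist R xs ys) {f : Fin (length ys) → Carrier} →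
    (∀ j → (∀ i → embed σ i ≢ j) → f j ≈ 0#) → ∑ (length ys) f ≈ ∑ (length xs) (f ∘ embed σ)
  ∑-embed [] f≈0 = refl
  ∑-embed (y ∷ʳ σ) f≈0 = trans (+-cong (f≈0 zero λ i ())
      (∑-embed σ λ j j∉ → f≈0 (suc j) λ i eq → j∉ i (suc-injective eq)))
    (+-identityˡ _)
  ∑-embed (r ∷ σ) f≈0 = +-congˡ (∑-embed σ λ j j∉ → f≈0 (suc j) λ { (suc i) eq → j∉ i (suc-injective eq) })

  affineFn-neg : ∀ (w : Point e) w₀ y → affineFn (λ c → - w c) (- w₀) y ≈ (- affineFn w w₀ y)
  affineFn-neg {e} w w₀ y = trans (+-congʳ (trans (∑-cong {e} λ c →
      trans (sym (-‿distribˡ-* (w c) (y c))) (sym (-1*x≈-x _))) (trans (∑-*ˡ {e} _ _) (-1*x≈-x _))))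
    (-‿+-comm _ _)

  AffDep-extend : ∀ {d m} (q : Fin (suc m) → Point d) → AffDep (q ∘ suc) → AffDep q
  AffDep-extend {m = m} q (μ , ∑≈0 , dep , j , μj≉0) =
    (λ { zero → 0# ; (suc i) → μ i }) , trans (+-identityˡ _) ∑≈0 ,
    (λ c → trans (+-cong (zeroˡ (q zero c)) (dep c)) (+-identityˡ 0#)) , suc j , μj≉0

  AffDep-resp : ∀ {d m} {q q′ : Fin m → Point d} → (∀ j → q j ≡ q′ j) → AffDep q → AffDep q′
  AffDep-resp {m = m} {q} {q′} q≡q′ (μ , ∑≈0 , dep , ≉0) = μ , ∑≈0 ,
    (λ c → trans (∑-cong {m} λ j → *-congˡ (reflexive (≡.cong (λ x → x c) (≡.sym (q≡q′ j))))) (dep c)) , ≉0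

  -- `GeneralPosition` excludes dependent (i + 2)-tuples only from i = 1 on, which in the plane says
  -- nothing about pairs. Adding one further point of `H` makes the tuple long enough for i = e + 1.
  independent : ∀ {e} (H : List (Point (suc (suc e)))) → GeneralPosition H → suc (suc (suc e)) ℕ.≤ length H →
    (t : Fin (suc (suc e)) → Fin (length H)) → Injective _≡_ _≡_ t → ¬ AffDep (λ j → pt H (t j))
  independent {e} H gp 3+e≤n t t-inj dep with any? (λ x → ¬? (any? λ i → t i Fin.≟ x))
  ... | no covered = ℕ.<⇒≱ 3+e≤n (injective⇒≤ {f = λ x → proj₁ (preimage x)} λ {x} {y} eq →
          ≡.trans (≡.sym (proj₂ (preimage x))) (≡.trans (≡.cong t eq) (proj₂ (preimage y))))
    where
    preimage : ∀ x → ∃ λ i → t i ≡ x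
    preimage x = decidable-stable (any? λ i → t i Fin.≟ x) λ ¬pre → covered (x , ¬pre)
  ... | yes (x , x∉t) = gp (suc e) (ℕ.s≤s ℕ.z≤n) (ℕ.n<1+n _) t′ t′-inj (AffDep-extend (pt H ∘ t′) dep)
    where
    t′ : Fin (suc (suc (suc e))) → Fin (length H)
    t′ zero = x
    t′ (suc i) = t i
    t′-inj : Injective _≡_ _≡_ t′
    t′-inj {zero} {zero} eq = ≡.refl
    t′-inj {zero} {suc j} eq = contradiction (j , ≡.sym eq) x∉t
    t′-inj {suc i} {zero} eq = contradiction (i , eq) x∉t
    t′-inj {suc i} {suc j} eq = ≡.cong suc (t-inj eq)

  module DeepBelowProperties {e} {H : List (Point (suc (suc e)))}
    (gp : GeneralPosition H) (3+e≤n : suc (suc (suc e)) ℕ.≤ length H) where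

    v : Fin (length H) → Point (suc e)
    v = π ∘ pt H

    h : Fin (length H) → Carrier
    h = lastCoord ∘ pt H

    private
      -- S is completed to a tuple of full size inside A, since BelowAllHyperplanes
      -- only speaks about hyperplanes spanned by that many points.
      module Tuple {A′ : List (Point (suc (suc e)))} (σ : A′ ⊑ H) (E : List (Point (suc (suc e))))
        {A S : Subset (length H)} (covers : ∀ {j} → j ∈ A → ∃ λ i → embed σ i ≡ j)
        (S⊆A : S ⊆ A) (∣S∣≤ : ∣ S ∣ ℕ.≤ suc (suc e)) (∣A∣≥ : suc (suc e) ℕ.≤ ∣ A ∣) where

        between = subset-between (suc (suc e)) S⊆A ∣S∣≤ ∣A∣≥
        T = proj₁ between
        S⊆T : S ⊆ T
        S⊆T = proj₁ (proj₂ between)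
        T⊆A : T ⊆ A
        T⊆A = proj₁ (proj₂ (proj₂ between))
        enumeration = enumerate T (proj₂ (proj₂ (proj₂ between)))
        t = proj₁ enumeration
        t-inj = proj₁ (proj₂ enumeration)
        t∈T = proj₁ (proj₂ (proj₂ enumeration))
        t-surj : ∀ {x} → x ∈ T → ∃ λ i → t i ≡ x
        t-surj = proj₂ (proj₂ (proj₂ enumeration))

        σ⁻¹ : ∀ k → ∃ λ i → embed σ i ≡ t k
        σ⁻¹ k = covers (T⊆A (t∈T k))

        s : Fin (suc (suc e)) → Fin (length (A′ ++ E))
        s k = embed (++⁺ʳ E (⊑-refl {x = A′})) (proj₁ (σ⁻¹ k))

        s-inj : Injective _≡_ _≡_ s
        s-inj {k} {l} eq = t-inj (≡.trans (≡.sym (proj₂ (σ⁻¹ k))) (≡.trans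
          (≡.cong (embed σ) (embed-injective (++⁺ʳ E (⊑-refl {x = A′})) eq)) (proj₂ (σ⁻¹ l))))

        pt-s : ∀ k → pt (A′ ++ E) (s k) ≡ pt H (t k)
        pt-s k = ≡.trans (≡.sym (lookup-embed (++⁺ʳ E (⊑-refl {x = A′})) _))
          (≡.trans (lookup-embed σ _) (≡.cong (pt H) (proj₂ (σ⁻¹ k))))

        s-independent : ¬ AffDep (λ k → pt (A′ ++ E) (s k))
        s-independent dep = independent H gp 3+e≤n t t-inj (AffDep-resp pt-s dep)

        graph : ∀ (w : Point (suc e)) w₀ → (∀ k → affineFn w w₀ (π (pt (A′ ++ E) (s k))) ≈ lastCoord
            (pt (A′ ++ E) (s k))) →
          Graph v h S w w₀
        graph w w₀ g j j∈S with t-surj (S⊆T j∈S)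
        ... | k , ≡.refl = ≡.subst (λ x → affineFn w w₀ (π x) ≈ lastCoord x) (pt-s k) (g k)

      All-lookup : ∀ {P : Point (suc (suc e)) → Set} {B′ : List (Point (suc (suc e)))} (σ : B′ ⊑ H) E {j} →
        (∃ λ i → embed σ i ≡ j) → All.All P (B′ ++ E) → P (pt H j)
      All-lookup {P} {B′} σ E (i , ≡.refl) Ps = ≡.subst P
        (≡.trans (≡.sym (lookup-embed (++⁺ʳ E (⊑-refl {x = B′})) i)) (lookup-embed σ i))
        (All.lookup Ps (∈-lookup (embed (++⁺ʳ E (⊑-refl {x = B′})) i)))

    module _ {A′ B′ : List (Point (suc (suc e)))} (σ : A′ ⊑ H) (τ : B′ ⊑ H) {A B : Subset (length H)}
      (coversA : ∀ {j} → j ∈ A → ∃ λ i → embed σ i ≡ j) (coversB : ∀ {j} → j ∈ B → ∃ λ i → embed τ i ≡ j) where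

      -- `DeepBelow` may enlarge both sets, but `A′` and `B′` remain prefixes of the enlarged lists,
      -- so tuples and points of `H` can be carried over.
      DeepBelow⇒under : DeepBelow B′ A′ → suc (suc e) ℕ.≤ ∣ A ∣ → UnderHyperplanes v h B A
      DeepBelow⇒under (EA , EB , _ , _ , _ , _ , below , _) ∣A∣≥ S S⊆A ∣S∣≤ with below T.s T.s-inj T.s-independent
        where module T = Tuple σ EA coversA S⊆A ∣S∣≤ ∣A∣≥
      ... | w , w₀ , g , under = w , w₀ , T.graph w w₀ g ,
              λ b b∈B → All-lookup {P = λ x → lastCoord x <ᶠ affineFn w w₀ (π x)} τ EB (coversB b∈B) under
        where module T = Tuple σ EA coversA S⊆A ∣S∣≤ ∣A∣≥

      -- Reflecting the hyperplane in height 0 brings the second half of deepness into the form of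
      -- the first.
      DeepBelow⇒over : DeepBelow B′ A′ → suc (suc e) ℕ.≤ ∣ B ∣ → UnderHyperplanes v (λ j → - h j) A B
      DeepBelow⇒over (EA , EB , _ , _ , _ , _ , _ , above) ∣B∣≥ S S⊆B ∣S∣≤ with above T.s T.s-inj T.s-independent
        where module T = Tuple τ EB coversB S⊆B ∣S∣≤ ∣B∣≥
      ... | w , w₀ , g , over = (λ c → - w c) , - w₀ ,
              (λ j j∈S → trans (affineFn-neg w w₀ (v j)) (-‿cong (T.graph w w₀ g j j∈S))) ,
              λ a a∈A → <-respʳ (sym (affineFn-neg w w₀ (v a))) (-‿anti-<
                (All-lookup {P = λ x → affineFn w w₀ (π x) <ᶠ lastCoord x} σ EA (coversA a∈A) over))
        where module T = Tuple τ EB coversB S⊆B ∣S∣≤ ∣B∣≥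

-- Extremal classes and class sizes

1≤∣p∣ : ∀ {n} {p : Subset n} {x} → x ∈ p → 1 ℕ.≤ ∣ p ∣
1≤∣p∣ x∈p = ℕ.≤-trans (ℕ.s≤s ℕ.z≤n) (x∈p⇒∣p-x∣<∣p∣ x∈p)

-- Splitting again and again and keeping `J` ends with one element; any other element of `I` is
-- related to it by the split at which the two parted.
extremal : ∀ {p} {R : Fin p → Fin p → Set} →
  (∀ I → 2 ℕ.≤ ∣ I ∣ → ∃ λ J → J ⊆ I × Nonempty J × Nonempty (I ─ J) × (∀ {x y} → x ∈ J → y ∈ I → y ∉ J → R x y)) →
  ∀ I → Nonempty I → ∃ λ x → x ∈ I × (∀ y → y ∈ I → y ≢ x → R x y)
extremal {p} {R} split I I≢∅ = go ∣ I ∣ I I≢∅ ℕ.≤-refl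
  where
  go : ∀ k I → Nonempty I → ∣ I ∣ ℕ.≤ k → ∃ λ x → x ∈ I × (∀ y → y ∈ I → y ≢ x → R x y)
  go zero I (x , x∈I) ∣I∣≤0 = contradiction (ℕ.≤-trans (1≤∣p∣ x∈I) ∣I∣≤0) λ ()
  go (suc k) I (x , x∈I) ∣I∣≤1+k with 2 ℕ.≤? ∣ I ∣
  ... | no ∣I∣<2 = x , x∈I , λ y y∈I y≢x → contradiction
        (ℕ.≤-trans (ℕ.s≤s (1≤∣p∣ (x∈p∧x≢y⇒x∈p-y y∈I y≢x))) (x∈p⇒∣p-x∣<∣p∣ x∈I)) ∣I∣<2
  ... | yes 2≤∣I∣ with split I 2≤∣I∣
  ...   | J , J⊆I , J≢∅ , (z , z∈I─J) , JRI─J with go k J J≢∅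
            (ℕ.s≤s⁻¹ (ℕ.≤-trans (p⊂q⇒∣p∣<∣q∣ (J⊆I , z , p─q⊆p I J z∈I─J , x∈p─q⇒x∉q I J z∈I─J)) ∣I∣≤1+k))
  ...     | x′ , x′∈J , least = x′ , J⊆I x′∈J , λ y y∈I y≢x′ → case y∈I y≢x′ (y ∈? J)
    where
    case : ∀ {y} → y ∈ I → y ≢ x′ → Dec (y ∈ J) → R x′ y
    case y∈I y≢x′ (yes y∈J) = least _ y∈J y≢x′
    case y∈I y≢x′ (no y∉J) = JRI─J x′∈J y∈I y∉J

-- The indices c + q p with q < n / p are distinct, stay below n and are congruent to c.
∣classes∣≥ : ∀ p .{{_ : NonZero p}} n {J : Subset p} {c} → c ∈ J → n / p ℕ.≤ ∣ classes p n J ∣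
∣classes∣≥ p n {J} {c} c∈J = injection⇒≤∣p∣ t t-inj λ q → ∈-classes⁺ p (≡.subst (_∈ J) (≡.sym (t-class q)) c∈J)
  where
  bound : ∀ (q : Fin (n / p)) → toℕ c ℕ.+ toℕ q ℕ.* p ℕ.< n
  bound q = begin-strict
    toℕ c ℕ.+ toℕ q ℕ.* p <⟨ ℕ.+-monoˡ-< (toℕ q ℕ.* p) (toℕ<n c) ⟩
    suc (toℕ q) ℕ.* p     ≤⟨ ℕ.*-monoˡ-≤ p (toℕ<n q) ⟩
    (n / p) ℕ.* p         ≤⟨ m/n*n≤m n p ⟩
    n                     ∎
    where open ℕ.≤-Reasoning
  t : Fin (n / p) → Fin n
  t q = Fin.fromℕ< (bound q)
  t-inj : Injective _≡_ _≡_ t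
  t-inj {q} {q′} eq = toℕ-injective (ℕ.*-cancelʳ-≡ _ _ p (ℕ.+-cancelˡ-≡ (toℕ c) _ _
    (≡.trans (≡.sym (toℕ-fromℕ< (bound q))) (≡.trans (≡.cong toℕ eq) (toℕ-fromℕ< (bound q′))))))
  t-class : ∀ q → mod-class p (t q) ≡ c
  t-class q = toℕ-injective (≡.trans (toℕ-fromℕ< _) (≡.trans (≡.cong (_% p) (toℕ-fromℕ< (bound q)))
    (≡.trans ([m+kn]%n≡m%n (toℕ c) (toℕ q) p) (m<n⇒m%n≡m (toℕ<n c)))))

n≤primeFrom : ∀ f n → n ℕ.≤ primeFrom f n
n≤primeFrom zero n = ℕ.≤-refl
n≤primeFrom (suc f) n with prime? n
... | yes _ = ℕ.≤-refl
... | no _ = ℕ.≤-trans (ℕ.n≤1+n n) (n≤primeFrom f (suc n))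

2≤primeSeq : ∀ e → 2 ℕ.≤ primeSeq e
2≤primeSeq zero = ℕ.≤-refl
2≤primeSeq (suc e) = ℕ.≤-trans (2≤primeSeq e) (ℕ.≤-trans (ℕ.n≤1+n _)
    (n≤primeFrom (primeSeq e ℕ.!) (suc (primeSeq e))))

-- An island only has to keep the points outside I away from its convex hull;
-- testing the points of I as well (against the rest of I) adds convex position.
data Mode : Set where
  island hole : Mode

Guard : ∀ {n} → Mode → Subset n → Fin n → Set
Guard island I a = a ∉ I
Guard hole I a = ⊤′

Guard-mono : ∀ {n m} mode {I : Subset n} {J : Subset m} {a b} → (b ∈ J → a ∈ I) → Guard mode I a → Guard mode J b
Guard-mono island b∈J⇒a∈I a∉I = a∉I ∘ b∈J⇒a∈I
Guard-mono hole _ _ = tt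

-- Merging a set from the upper part with one from the lower part

module Merging (F : OrderedField) where
  open OrderedField F hiding (zero; _-_) renaming (_*_ to _*ᶠ_)
  open Geometry F
  open OrderedFieldProperties F
  open Convexity F
  open Separation F
  open Selection F

  private
    variable
      n m e : ℕ

  -- The condition on one side of a merge. Heights are kept for the sake of the plane, where three
  -- projected points lie on a line and never form a hole.
  HullFree : Mode → (Fin n → Point e) → (Fin n → Carrier) → Subset n → Set
  HullFree mode v h I = ∀ a → Guard mode I a → ¬ UnderHull v h (I - a) a

  ConvFree : ∀ {d} → Mode → (H : List (Point d)) → Subset (length H) → Set
  ConvFree mode H I = ∀ a → Guard mode I a → ¬ InConv H (I - a) (pt H a)

  UnderHyperplanes-mono : ∀ (v : Fin n → Point e) h {A A′ B B′ : Subset n} → B′ ⊆ B → A′ ⊆ A →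
    UnderHyperplanes v h B A → UnderHyperplanes v h B′ A′
  UnderHyperplanes-mono v h B′⊆B A′⊆A under S S⊆A′ ∣S∣≤ with under S (A′⊆A ∘ S⊆A′) ∣S∣≤
  ... | w , w₀ , graph , below = w , w₀ , graph , λ b b∈B′ → below b (B′⊆B b∈B′)

  UnderHyperplanes-cong : ∀ (v : Fin n → Point e) {h h′} {A B : Subset n} → (∀ j → h j ≈ h′ j) →
    UnderHyperplanes v h B A → UnderHyperplanes v h′ B A
  UnderHyperplanes-cong v h≈h′ under S S⊆A ∣S∣≤ with under S S⊆A ∣S∣≤
  ... | w , w₀ , graph , below = w , w₀ , (λ j j∈S → trans (graph j j∈S) (h≈h′ j)) ,
        λ b b∈B → <-respˡ (h≈h′ b) (below b b∈B)

  UnderHull-pullback : ∀ {A B : Set} {R : A → B → Set} {xs ys} (σ : Sublist R xs ys)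
    (v : Fin (length ys) → Point e) (h : Fin (length ys) → Carrier) {S : Subset (length ys)} {T : Subset (length xs)}
        {a} →
    S ⊆ image σ T → UnderHull v h S (embed σ a) → UnderHull (v ∘ embed σ) (h ∘ embed σ) T a
  UnderHull-pullback {xs = xs} {ys} σ v h {S} {T} S⊆σT u = record
    { weight = U.weight ∘ embed σ
    ; nonneg = U.nonneg ∘ embed σ
    ; supported = λ i i∉T → U.supported (embed σ i) λ i∈S → i∉T (∈-image-embed⁻ σ (S⊆σT i∈S))
    ; total = trans (sym (∑-embed σ outside-image)) U.total
    ; combines = λ c → trans (sym (∑-embed σ (product-zero (λ j → v j c)))) (U.combines c)
    ; height = ≤-trans U.height (inj₂ (∑-embed σ (product-zero h))) }
    where
    module U = UnderHull u
    outside-image : ∀ j → (∀ i → embed σ i ≢ j) → U.weight j ≈ 0#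
    outside-image j j∉ = U.supported j λ j∈S → case (∈-image⁻ σ (S⊆σT j∈S))
      where
      case : ¬ (∃ λ i → i ∈ T × embed σ i ≡ j)
      case (i , _ , eq) = j∉ i eq
    product-zero : ∀ (x : Fin (length ys) → Carrier) j → (∀ i → embed σ i ≢ j) → (U.weight j *ᶠ x j) ≈ 0#
    product-zero x j j∉ = trans (*-congʳ (outside-image j j∉)) (zeroˡ (x j))

  -- The case of a point `a` in the upper part, for arbitrary heights, so that the lower part is the
  -- same statement after negation. `underHull` discards the points from `J`; what remains is in
  -- `C`. If `a` is outside `C`, it lies above the hyperplanes of `C`, and if it is inside, `free`
  -- excludes it.
  one-sided : ∀ {A B : Set} {R : A → B → Set} {xs ys} (σ : Sublist R xs ys) mode
    (v : Fin (length ys) → Point e) (h : Fin (length ys) → Carrier) (A B C : Subset (length ys)) →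
    UnderHyperplanes v h B A → (∀ {j} → j ∈ A → j ∉ B) → C ⊆ A →
    (∀ {a} → a ∈ A → a ∉ C → UnderHyperplanes v (λ j → - h j) ⁅ a ⁆ C) →
    (∀ {j} → j ∈ C → ∃ λ i → embed σ i ≡ j) → (∀ i → embed σ i ∈ C) →
    ∀ {I₁ J I a} → HullFree mode (v ∘ embed σ) (h ∘ embed σ) I₁ → J ⊆ B →
    image σ I₁ ⊆ I → (∀ {x} → x ∈ I → x ∈ image σ I₁ ⊎ x ∈ J) → a ∈ A → Guard mode I a →
    ∀ {μ} → Nonneg μ → Supported (I - a) μ → ∑ (length ys) μ ≈ 1# → (∀ c → comb μ v c ≈ v a c) →
    ¬ (∑ (length ys) (λ j → μ j *ᶠ h j) ≈ h a)
  one-sided {xs = xs} {ys} σ mode v h A B C B<A disjoint C⊆A A>C covers into {I₁} {J} {I} {a} free J⊆B I₁⊆I I⊆ a∈A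
      guard
    {μ} nonneg supported total combines height = case (a ∈? C)
    where
    S = (I - a) ∩ A
    under : UnderHull v h S a
    under = underHull v h A B B<A disjoint {I - a} split a∈A (x∉p-x I a) nonneg supported total combines height
      where
      split : ∀ {j} → j ∈ I - a → j ∈ A ⊎ j ∈ B
      split j∈ with I⊆ (x∈p-y⇒x∈p a j∈)
      ... | inj₂ j∈J = inj₂ (J⊆B j∈J)
      ... | inj₁ j∈σ with ∈-image⁻ σ j∈σ
      ...   | i , _ , ≡.refl = inj₁ (C⊆A (into i))
    S⊆image : ∀ {j} → j ∈ S → j ∈ image σ I₁
    S⊆image j∈S with I⊆ (x∈p-y⇒x∈p a (p∩q⊆p (I - a) A j∈S))
    ... | inj₁ j∈σ = j∈σ
    ... | inj₂ j∈J = contradiction (J⊆B j∈J) (disjoint (p∩q⊆q (I - a) A j∈S))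
    S⊆C : S ⊆ C
    S⊆C j∈S with ∈-image⁻ σ (S⊆image j∈S)
    ... | i , _ , ≡.refl = into i
    contra : ∀ i → embed σ i ≡ a → ⊥′
    contra i ≡.refl = free i (Guard-mono mode (I₁⊆I ∘ ∈-image⁺ σ) guard) (UnderHull-pullback σ v h S⊆ under)
      where
      S⊆ : S ⊆ image σ (I₁ - i)
      S⊆ j∈S with ∈-image⁻ σ (S⊆image j∈S)
      ... | i′ , i′∈I₁ , ≡.refl = ∈-image⁺ σ (x∈p∧x≢y⇒x∈p-y i′∈I₁
              λ { ≡.refl → x∉p-x I a (p∩q⊆p (I - a) A j∈S) })
    case : Dec (a ∈ C) → ⊥′
    case (no a∉C) = over⇒¬underHull v h ⁅ a ⁆ C (A>C a∈A a∉C) S⊆C (x∈⁅x⁆ a) under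
    case (yes a∈C) = contra (proj₁ (covers a∈C)) (proj₂ (covers a∈C))

  -- `j` is the lowest class of the upper part and `i` the highest class of the lower part. `A>Cⱼ`
  -- and `B<Cᵢ` compare single points, because the other classes are separated from the extremal one
  -- at different splits.
  record Splitting {e} (p : ℕ) .{{_ : NonZero p}} (H : List (Point (suc (suc e)))) : Set where
    v : Fin (length H) → Point (suc e)
    v = π ∘ pt H
    h : Fin (length H) → Carrier
    h = lastCoord ∘ pt H
    field
      A B : Subset (length H)
      j i : Fin p
    Cⱼ : Subset (length H)
    Cⱼ = classes p (length H) ⁅ j ⁆
    Cᵢ : Subset (length H)
    Cᵢ = classes p (length H) ⁅ i ⁆
    field
      j≢i : j ≢ i
      cover : ∀ a → a ∈ A ⊎ a ∈ B
      disjoint : ∀ {a} → a ∈ A → a ∉ B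
      B<A : UnderHyperplanes v h B A
      A>B : UnderHyperplanes v (λ x → - h x) A B
      Cⱼ⊆A : Cⱼ ⊆ A
      Cᵢ⊆B : Cᵢ ⊆ B
      A>Cⱼ : ∀ {a} → a ∈ A → a ∉ Cⱼ → UnderHyperplanes v (λ x → - h x) ⁅ a ⁆ Cⱼ
      B<Cᵢ : ∀ {b} → b ∈ B → b ∉ Cᵢ → UnderHyperplanes v h ⁅ b ⁆ Cᵢ

  -- The bound on n / p gives every class enough points to span a hyperplane; the bound on n
  -- supplies the extra point for `independent`.
  splitting : ∀ {e} (H : List (Point (suc (suc e)))) → GeneralPosition H → SplitCond e H →
    suc (suc (suc e)) ℕ.≤ length H → suc (suc e) ℕ.≤ _/_ (length H) (primeSeq e) {{primeSeq-nz e}} →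
    Splitting (primeSeq e) {{primeSeq-nz e}} H
  splitting {e} H gp split 3+e≤n 2+e≤n/p = record
    { A = cls upper ; B = cls lower ; j = proj₁ bottom ; i = proj₁ top
    ; j≢i = λ j≡i → x∈p─q⇒x∉q full lower (proj₁ (proj₂ bottom)) (≡.subst (_∈ lower) (≡.sym j≡i) (proj₁ (proj₂ top)))
    ; cover = cover ; disjoint = disjoint
    ; B<A = proj₁ (deep full 2≤∣full∣) ; A>B = proj₂ (deep full 2≤∣full∣)
    ; Cⱼ⊆A = ⁅x⁆-cls (proj₁ (proj₂ bottom)) ; Cᵢ⊆B = ⁅x⁆-cls (proj₁ (proj₂ top))
    ; A>Cⱼ = λ a∈A a∉C → UnderHyperplanes-mono v (λ x → - h x) ⁅a⁆⊆ (λ x → x)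
        (proj₂ (proj₂ bottom) _ (∈-classes⁻ p a∈A) (≢-class a∉C))
    ; B<Cᵢ = λ b∈B b∉C → UnderHyperplanes-mono v h ⁅a⁆⊆ (λ x → x)
        (proj₂ (proj₂ top) _ (∈-classes⁻ p b∈B) (≢-class b∉C)) }
    where
    p = primeSeq e
    instance
      p-nonZero : NonZero p
      p-nonZero = primeSeq-nz e
    open DeepBelowProperties {e} {H} gp 3+e≤n
    full : Subset p
    full = ⊤
    2≤∣full∣ : 2 ℕ.≤ ∣ full ∣
    2≤∣full∣ = ℕ.≤-trans (2≤primeSeq e) (ℕ.≤-reflexive (≡.sym (∣⊤∣≡n p)))
    cls : Subset p → Subset (length H)
    cls = classes p (length H)
    deep : ∀ I (2≤∣I∣ : 2 ℕ.≤ ∣ I ∣) → UnderHyperplanes v h (cls (proj₁ (split I 2≤∣I∣)))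
        (cls (I ─ proj₁ (split I 2≤∣I∣))) ×
      UnderHyperplanes v (λ x → - h x) (cls (I ─ proj₁ (split I 2≤∣I∣))) (cls (proj₁ (split I 2≤∣I∣)))
    deep I 2≤∣I∣ with split I 2≤∣I∣
    ... | J , J⊆I , (x , x∈J) , (y , y∈) , below =
          DeepBelow⇒under (union-⊑ p (I ─ J) H) (union-⊑ p J H) (union-surjective p (I ─ J) H)
              (union-surjective p J H)
            below (ℕ.≤-trans 2+e≤n/p (∣classes∣≥ p (length H) y∈)) ,
          DeepBelow⇒over (union-⊑ p (I ─ J) H) (union-⊑ p J H) (union-surjective p (I ─ J) H) (union-surjective p J H)
            below (ℕ.≤-trans 2+e≤n/p (∣classes∣≥ p (length H) x∈J))
    lower upper : Subset p
    lower = proj₁ (split full 2≤∣full∣)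
    upper = full ─ lower
    ⁅x⁆-cls : ∀ {x J} → x ∈ J → cls ⁅ x ⁆ ⊆ cls J
    ⁅x⁆-cls {x} {J} x∈J {a} a∈ = ∈-classes⁺ p (≡.subst (_∈ J) (≡.sym (x∈⁅y⁆⇒x≡y x (∈-classes⁻ p a∈))) x∈J)
    ⁅a⁆⊆ : ∀ {a} → ⁅ a ⁆ ⊆ cls ⁅ mod-class p a ⁆
    ⁅a⁆⊆ {a} x∈ with x∈⁅y⁆⇒x≡y a x∈
    ... | ≡.refl = ∈-classes⁺ p (x∈⁅x⁆ (mod-class p a))
    ≢-class : ∀ {a c} → a ∉ cls ⁅ c ⁆ → mod-class p a ≢ c
    ≢-class {a} a∉ ≡.refl = a∉ (∈-classes⁺ p (x∈⁅x⁆ (mod-class p a)))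
    cover : ∀ a → a ∈ cls upper ⊎ a ∈ cls lower
    cover a with mod-class p a ∈? lower
    ... | yes a∈ = inj₂ (∈-classes⁺ p a∈)
    ... | no a∉ = inj₁ (∈-classes⁺ p (x∈p∧x∉q⇒x∈p─q ∈⊤ a∉))
    disjoint : ∀ {a} → a ∈ cls upper → a ∉ cls lower
    disjoint a∈upper a∈lower = x∈p─q⇒x∉q full lower (∈-classes⁻ p a∈upper) (∈-classes⁻ p a∈lower)
    bottom : ∃ λ x → x ∈ upper × (∀ y → y ∈ upper → y ≢ x → UnderHyperplanes v (λ z → - h z) (cls ⁅ y ⁆) (cls ⁅ x ⁆))
    bottom = extremal {R = λ x y → UnderHyperplanes v (λ z → - h z) (cls ⁅ y ⁆) (cls ⁅ x ⁆)}
      (λ I 2≤∣I∣ → let (J , J⊆I , J≢∅ , I─J≢∅ , _) = split I 2≤∣I∣ in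
        J , J⊆I , J≢∅ , I─J≢∅ , λ x∈J y∈I y∉J →
          UnderHyperplanes-mono v (λ z → - h z) (⁅x⁆-cls (x∈p∧x∉q⇒x∈p─q y∈I y∉J)) (⁅x⁆-cls x∈J)
              (proj₂ (deep I 2≤∣I∣)))
      upper (proj₁ (proj₂ (proj₂ (proj₂ (split full 2≤∣full∣)))))
    top : ∃ λ x → x ∈ lower × (∀ y → y ∈ lower → y ≢ x → UnderHyperplanes v h (cls ⁅ y ⁆) (cls ⁅ x ⁆))
    -- Here the part kept at each split is the upper one, `I ─ J`.
    top = extremal {R = λ x y → UnderHyperplanes v h (cls ⁅ y ⁆) (cls ⁅ x ⁆)}
      (λ I 2≤∣I∣ → let (J , J⊆I , (z , z∈J) , I─J≢∅ , _) = split I 2≤∣I∣ in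
        I ─ J , p─q⊆p I J , I─J≢∅ , (z , x∈p∧x∉q⇒x∈p─q (J⊆I z∈J) λ z∈I─J → x∈p─q⇒x∉q I J z∈I─J z∈J) ,
        λ {x} {y} x∈I─J y∈I y∉I─J → UnderHyperplanes-mono v h
          (⁅x⁆-cls (decidable-stable (y ∈? J) λ y∉J → y∉I─J (x∈p∧x∉q⇒x∈p─q y∈I y∉J))) (⁅x⁆-cls x∈I─J)
          (proj₁ (deep I 2≤∣I∣)))
      lower (proj₁ (proj₂ (proj₂ (split full 2≤∣full∣))))

  merge : ∀ {X Y : Set} {R : X → Point (suc (suc e)) → Set} {R′ : Y → Point (suc (suc e)) → Set} {p}
      .{{_ : NonZero p}} {H : List (Point (suc (suc e)))} (s : Splitting p H) →
    let open Splitting s in ∀ {xs ys} (σ : Sublist R xs H) (τ : Sublist R′ ys H) mode →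
    (∀ {a} → a ∈ Cⱼ → ∃ λ k → embed σ k ≡ a) → (∀ k → embed σ k ∈ Cⱼ) →
    (∀ {a} → a ∈ Cᵢ → ∃ λ k → embed τ k ≡ a) → (∀ k → embed τ k ∈ Cᵢ) →
    ∀ {I₁ I₂} → HullFree mode (v ∘ embed σ) (h ∘ embed σ) I₁ →
        HullFree mode (v ∘ embed τ) ((λ x → - h x) ∘ embed τ) I₂ →
    ConvFree mode H (image σ I₁ ∪ image τ I₂)
  merge {H = H} s σ τ mode σ-covers σ-into τ-covers τ-into {I₁} {I₂} free₁ free₂ a guard
      (μ , nonneg , supported , total , combines)
    with Splitting.cover s a
  ... | inj₁ a∈A = one-sided σ mode v h A B Cⱼ B<A disjoint Cⱼ⊆A A>Cⱼ σ-covers σ-into free₁ τ⊆B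
          (p⊆p∪q (image τ I₂)) (x∈p∪q⁻ (image σ I₁) (image τ I₂)) a∈A guard nonneg supported total
          (λ c → combines (Fin.inject₁ c)) (combines (Fin.fromℕ _))
    where
    open Splitting s
    τ⊆B : image τ I₂ ⊆ B
    τ⊆B x∈ with ∈-image⁻ τ x∈
    ... | k , _ , ≡.refl = Cᵢ⊆B (τ-into k)
  -- Negating the heights exchanges `A` and `B`; `UnderHyperplanes-cong` accounts for the double
  -- negation.
  ... | inj₂ a∈B = one-sided τ mode v (λ x → - h x) B A Cᵢ A>B (λ x∈B x∈A → disjoint x∈A x∈B) Cᵢ⊆B
          (λ b∈B b∉C → UnderHyperplanes-cong v (λ x → sym (-‿involutive (h x))) (B<Cᵢ b∈B b∉C)) τ-covers τ-into free₂
              σ⊆A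
          (q⊆p∪q (image σ I₁) (image τ I₂)) (swap ∘ x∈p∪q⁻ (image σ I₁) (image τ I₂)) a∈B guard nonneg supported total
          (λ c → combines (Fin.inject₁ c)) (trans (∑-*-neg μ h) (-‿cong (combines (Fin.fromℕ _))))
    where
    open Splitting s
    σ⊆A : image σ I₁ ⊆ A
    σ⊆A x∈ with ∈-image⁻ σ x∈
    ... | k , _ , ≡.refl = Cⱼ⊆A (σ-into k)

-- Counting: intervals, exponents and product families

disjoint⇒∣p∪q∣≡∣p∣+∣q∣ : ∀ {n} (p q : Subset n) → (∀ {x} → x ∈ p → x ∉ q) → ∣ p ∪ q ∣ ≡ ∣ p ∣ ℕ.+ ∣ q ∣
disjoint⇒∣p∪q∣≡∣p∣+∣q∣ [] [] disjoint = ≡.refl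
disjoint⇒∣p∪q∣≡∣p∣+∣q∣ (inside ∷ p) (inside ∷ q) disjoint = contradiction here (disjoint here)
disjoint⇒∣p∪q∣≡∣p∣+∣q∣ (inside ∷ p) (outside ∷ q) disjoint =
  ≡.cong suc (disjoint⇒∣p∪q∣≡∣p∣+∣q∣ p q λ x∈p x∈q → disjoint (there x∈p) (there x∈q))
disjoint⇒∣p∪q∣≡∣p∣+∣q∣ (outside ∷ p) (inside ∷ q) disjoint = ≡.trans
  (≡.cong suc (disjoint⇒∣p∪q∣≡∣p∣+∣q∣ p q λ x∈p x∈q → disjoint (there x∈p) (there x∈q))) (≡.sym (ℕ.+-suc ∣ p ∣ ∣ q ∣))
disjoint⇒∣p∪q∣≡∣p∣+∣q∣ (outside ∷ p) (outside ∷ q) disjoint =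
  disjoint⇒∣p∪q∣≡∣p∣+∣q∣ p q λ x∈p x∈q → disjoint (there x∈p) (there x∈q)

length-cartesianProductWith : ∀ {A B C : Set} (f : A → B → C) xs ys →
  length (cartesianProductWith f xs ys) ≡ length xs * length ys
length-cartesianProductWith f [] ys = ≡.refl
length-cartesianProductWith f (x ∷ xs) ys = ≡.trans (length-++ (map (f x) ys))
  (≡.cong₂ ℕ._+_ (length-map (f x) ys) (length-cartesianProductWith f xs ys))

interval : ∀ n → ℕ → ℕ → Subset n
interval zero s k = []
interval (suc n) zero zero = outside ∷ interval n zero zero
interval (suc n) zero (suc k) = inside ∷ interval n zero k
interval (suc n) (suc s) k = outside ∷ interval n s k

∈-interval⁺ : ∀ {n s k} {j : Fin n} → s ≤ toℕ j → toℕ j ℕ.< s ℕ.+ k → j ∈ interval n s k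
∈-interval⁺ {s = zero} {suc k} {zero} _ _ = here
∈-interval⁺ {s = zero} {suc k} {suc j} _ j<k = there (∈-interval⁺ ℕ.z≤n (ℕ.s<s⁻¹ j<k))
∈-interval⁺ {s = suc s} {k} {suc j} s≤j j<s+k = there (∈-interval⁺ (ℕ.s≤s⁻¹ s≤j) (ℕ.s<s⁻¹ j<s+k))

∈-interval⁻ : ∀ {n s k} {j : Fin n} → j ∈ interval n s k → s ≤ toℕ j × toℕ j ℕ.< s ℕ.+ k
∈-interval⁻ {s = zero} {zero} {suc j} (there j∈) with ∈-interval⁻ {s = zero} {zero} j∈
... | _ , ()
∈-interval⁻ {s = zero} {suc k} {zero} here = ℕ.z≤n , ℕ.s≤s ℕ.z≤n
∈-interval⁻ {s = zero} {suc k} {suc j} (there j∈) = ℕ.z≤n , ℕ.s<s (proj₂ (∈-interval⁻ {s = zero} j∈))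
∈-interval⁻ {s = suc s} {k} {suc j} (there j∈) with ∈-interval⁻ {s = s} j∈
... | s≤j , j<s+k = ℕ.s≤s s≤j , ℕ.s<s j<s+k

∣interval∣ : ∀ n s k → s ℕ.+ k ≤ n → ∣ interval n s k ∣ ≡ k
∣interval∣ zero zero zero _ = ≡.refl
∣interval∣ (suc n) zero zero _ = ∣interval∣ n zero zero ℕ.z≤n
∣interval∣ (suc n) zero (suc k) k≤n = ≡.cong suc (∣interval∣ n zero k (ℕ.s≤s⁻¹ k≤n))
∣interval∣ (suc n) (suc s) k s+k≤n = ∣interval∣ n s k (ℕ.s≤s⁻¹ s+k≤n)

^-distribʳ-* : ∀ x m n → (m * n) ^ x ≡ m ^ x * n ^ x
^-distribʳ-* zero m n = ≡.refl
^-distribʳ-* (suc x) m n = ≡.trans (≡.cong (m * n *_) (^-distribʳ-* x m n))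
    (ℕ.[m*n]*[o*p]≡[m*o]*[n*p] m n (m ^ x) (n ^ x))

m*n≤o⇒m≤o/n : ∀ {m o} n .{{_ : NonZero n}} → m * n ≤ o → m ≤ o / n
m*n≤o⇒m≤o/n {m} n mn≤o = ℕ.≤-trans (ℕ.≤-reflexive (≡.sym (m*n/n≡m m n))) (/-monoˡ-≤ n mn≤o)

-- The factor 2 pays for rounding down: the remainder is below n, which is at most n times the
-- quotient.
m≤2*n*[m/n] : ∀ m n .{{_ : NonZero n}} → 1 ≤ m / n → m ≤ 2 * n * (m / n)
m≤2*n*[m/n] m n 1≤m/n = begin
  m                             ≡⟨ m≡m%n+[m/n]*n m n ⟩
  m % n ℕ.+ (m / n) * n         ≤⟨ ℕ.+-monoˡ-≤ _ (ℕ.<⇒≤ (m%n<n m n)) ⟩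
  n ℕ.+ (m / n) * n             ≡⟨ ≡.cong (ℕ._+ (m / n) * n) (ℕ.*-identityˡ n) ⟨
  1 * n ℕ.+ (m / n) * n         ≤⟨ ℕ.+-monoˡ-≤ _ (ℕ.*-monoˡ-≤ n 1≤m/n) ⟩
  (m / n) * n ℕ.+ (m / n) * n   ≡⟨ ≡.cong₂ ℕ._+_ (ℕ.*-comm (m / n) n) (ℕ.*-comm (m / n) n) ⟩
  n * (m / n) ℕ.+ n * (m / n)   ≡⟨ ≡.cong (n * (m / n) ℕ.+_) (ℕ.+-identityʳ _) ⟨
  2 * (n * (m / n))             ≡⟨ ℕ.*-assoc 2 n (m / n) ⟨
  2 * n * (m / n)               ∎
  where open ℕ.≤-Reasoning

n≤2m⇒⌈n/2⌉≤m : ∀ {n} m → n ≤ 2 * m → ⌈ n /2⌉ ≤ m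
n≤2m⇒⌈n/2⌉≤m {n} m n≤2m = ℕ.≤-trans (ℕ.⌈n/2⌉-mono n≤2m) (ℕ.≤-reflexive
  (≡.trans (≡.cong (λ x → ⌈ m ℕ.+ x /2⌉) (ℕ.+-identityʳ m)) (≡.sym (ℕ.n≡⌈n+n/2⌉ m))))

2m≤n⇒m≤⌊n/2⌋ : ∀ {n} m → 2 * m ≤ n → m ≤ ⌊ n /2⌋
2m≤n⇒m≤⌊n/2⌋ m 2m≤n = ℕ.≤-trans (ℕ.≤-reflexive
  (≡.trans (ℕ.n≡⌊n+n/2⌋ m) (≡.cong (λ x → ⌊ m ℕ.+ x /2⌋) (≡.sym (ℕ.+-identityʳ m))))) (ℕ.⌊n/2⌋-mono 2m≤n)

-- This adds the exponents of two merged families. The minima never disagree: 2 q ≤ k puts q below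
-- both halves, and k ≤ 2 q puts both halves below q.
⊓-halves : ∀ q k → (q ⊓ ⌊ k /2⌋) ℕ.+ (q ⊓ ⌈ k /2⌉) ≡ 2 * q ⊓ k
⊓-halves q k with ℕ.≤-total (2 * q) k
... | inj₁ 2q≤k = begin
  (q ⊓ ⌊ k /2⌋) ℕ.+ (q ⊓ ⌈ k /2⌉) ≡⟨ ≡.cong₂ ℕ._+_ (ℕ.m≤n⇒m⊓n≡m q≤) (ℕ.m≤n⇒m⊓n≡m (ℕ.≤-trans q≤ (ℕ.⌊n/2⌋≤⌈n/2⌉ k))) ⟩
  q ℕ.+ q                         ≡⟨ ≡.cong (q ℕ.+_) (ℕ.+-identityʳ q) ⟨
  2 * q                           ≡⟨ ℕ.m≤n⇒m⊓n≡m 2q≤k ⟨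
  2 * q ⊓ k                       ∎
  where
  open ≡.≡-Reasoning
  q≤ : q ≤ ⌊ k /2⌋
  q≤ = 2m≤n⇒m≤⌊n/2⌋ q 2q≤k
... | inj₂ k≤2q = begin
  (q ⊓ ⌊ k /2⌋) ℕ.+ (q ⊓ ⌈ k /2⌉) ≡⟨ ≡.cong₂ ℕ._+_ (ℕ.m≥n⇒m⊓n≡n (ℕ.≤-trans (ℕ.⌊n/2⌋≤⌈n/2⌉ k) ≤q)) (ℕ.m≥n⇒m⊓n≡n ≤q) ⟩
  ⌊ k /2⌋ ℕ.+ ⌈ k /2⌉             ≡⟨ ℕ.⌊n/2⌋+⌈n/2⌉≡n k ⟩
  k                               ≡⟨ ℕ.m≥n⇒m⊓n≡n k≤2q ⟨
  2 * q ⊓ k                       ∎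
  where
  open ≡.≡-Reasoning
  ≤q : ⌈ k /2⌉ ≤ q
  ≤q = n≤2m⇒⌈n/2⌉≤m q k≤2q

-- The bound Ω(n^x) without division: `C` is the reciprocal of the implied constant.
record Family {n} (P : Subset n → Set) (k x C : ℕ) : Set where
  field
    list : List (Subset n)
    unique : Unique list
    members : All (λ I → ∣ I ∣ ≡ k × P I) list
    count : n ^ x ≤ C * length list

Family-map : ∀ {n} {P Q : Subset n → Set} {k x C} → (∀ {I} → P I → Q I) → Family P k x C → Family Q k x C
Family-map P⇒Q f = record
  { list = list ; unique = unique ; members = All.map (map₂ P⇒Q) members ; count = count }
  where open Family f

module _ {A B D : Set} {R₁ : A → D → Set} {R₂ : B → D → Set} {xs ys zs}
  (σ : Sublist R₁ xs zs) (τ : Sublist R₂ ys zs) (disjoint : ∀ i j → embed σ i ≢ embed τ j) where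

  image-disjoint : ∀ {S T x} → x ∈ image σ S → x ∉ image τ T
  image-disjoint x∈σ x∈τ with ∈-image⁻ σ x∈σ | ∈-image⁻ τ x∈τ
  ... | i , _ , ≡.refl | j , _ , eq = disjoint i j (≡.sym eq)

  image-∪-injective : ∀ {S S′ T T′} → image σ S ∪ image τ T ≡ image σ S′ ∪ image τ T′ → S ≡ S′ × T ≡ T′
  image-∪-injective eq = ⊆-antisym (left eq) (left (≡.sym eq)) , ⊆-antisym (right eq) (right (≡.sym eq))
    where
    left : ∀ {S S′ T T′} → image σ S ∪ image τ T ≡ image σ S′ ∪ image τ T′ → S ⊆ S′
    left {S} {S′} {T} {T′} eq {i} i∈S
      with x∈p∪q⁻ (image σ S′) (image τ T′) (≡.subst (embed σ i ∈_) eq (x∈p∪q⁺ (inj₁ (∈-image⁺ σ i∈S))))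
    ... | inj₁ i∈ = ∈-image-embed⁻ σ i∈
    ... | inj₂ i∈ = contradiction i∈ (image-disjoint (∈-image⁺ σ i∈S))
    right : ∀ {S S′ T T′} → image σ S ∪ image τ T ≡ image σ S′ ∪ image τ T′ → T ⊆ T′
    right {S} {S′} {T} {T′} eq {i} i∈T
      with x∈p∪q⁻ (image σ S′) (image τ T′) (≡.subst (embed τ i ∈_) eq (x∈p∪q⁺ (inj₂ (∈-image⁺ τ i∈T))))
    ... | inj₂ i∈ = ∈-image-embed⁻ τ i∈
    ... | inj₁ i∈ = contradiction (∈-image⁺ τ i∈T) (image-disjoint i∈)

  -- Each side holds at least a 1/D share of the points, so passing from its size to that of the
  -- whole costs a factor D ^ x. As the images are disjoint, a union determines its two parts and
  -- the product has no repetitions.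
  Family-∪ : ∀ {P Q S k₁ k₂ x₁ x₂ C₁ C₂} D → length zs ≤ D * length xs → length zs ≤ D * length ys →
    (∀ {I J} → P I → Q J → S (image σ I ∪ image τ J)) → Family P k₁ x₁ C₁ → Family Q k₂ x₂ C₂ →
    Family S (k₁ ℕ.+ k₂) (x₁ ℕ.+ x₂) (D ^ x₁ * C₁ * (D ^ x₂ * C₂))
  Family-∪ {x₁ = x₁} {x₂} {C₁} {C₂} D n≤Dm₁ n≤Dm₂ P×Q⇒S f g = record
    { list = cartesianProductWith (λ I J → image σ I ∪ image τ J) F.list G.list
    ; unique = Unique.cartesianProductWith⁺ _ image-∪-injective F.unique G.unique
    ; members = All.cartesianProductWith⁺ (≡.setoid _) (≡.setoid _) _ F.list G.list λ {I} {J} I∈ J∈ →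
        let (∣I∣≡k₁ , PI) = All.lookup F.members I∈
            (∣J∣≡k₂ , QJ) = All.lookup G.members J∈ in
        ≡.trans (disjoint⇒∣p∪q∣≡∣p∣+∣q∣ (image σ I) (image τ J) image-disjoint)
          (≡.cong₂ ℕ._+_ (≡.trans (∣image∣ σ I) ∣I∣≡k₁) (≡.trans (∣image∣ τ J) ∣J∣≡k₂)) , P×Q⇒S PI QJ
    ; count = begin
        length zs ^ (x₁ ℕ.+ x₂)
          ≡⟨ ℕ.^-distribˡ-+-* (length zs) x₁ x₂ ⟩
        length zs ^ x₁ * length zs ^ x₂
          ≤⟨ ℕ.*-mono-≤ (power x₁ n≤Dm₁ F.count) (power x₂ n≤Dm₂ G.count) ⟩
        (D ^ x₁ * C₁ * length F.list) * (D ^ x₂ * C₂ * length G.list)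
          ≡⟨ ℕ.[m*n]*[o*p]≡[m*o]*[n*p] (D ^ x₁ * C₁) (length F.list) (D ^ x₂ * C₂) (length G.list) ⟩
        (D ^ x₁ * C₁ * (D ^ x₂ * C₂)) * (length F.list * length G.list)
          ≡⟨ ≡.cong ((D ^ x₁ * C₁ * (D ^ x₂ * C₂)) *_) (length-cartesianProductWith _ F.list G.list) ⟨
        (D ^ x₁ * C₁ * (D ^ x₂ * C₂)) * length (cartesianProductWith (λ I J → image σ I ∪ image τ J) F.list G.list) ∎
            }
    where
    module F = Family f
    module G = Family g
    open ℕ.≤-Reasoning
    power : ∀ {n m C l} x → n ≤ D * m → m ^ x ≤ C * l → n ^ x ≤ D ^ x * C * l
    power {n} {m} {C} {l} x n≤Dm m^x≤Cl = begin
      n ^ x             ≤⟨ ℕ.^-monoˡ-≤ x n≤Dm ⟩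
      (D * m) ^ x       ≡⟨ ^-distribʳ-* x D m ⟩
      D ^ x * m ^ x     ≤⟨ ℕ.*-monoʳ-≤ (D ^ x) m^x≤Cl ⟩
      D ^ x * (C * l)   ≡⟨ ℕ.*-assoc (D ^ x) C l ⟨
      D ^ x * C * l     ∎

module _ {A B : Set} (f : B → A) where

  map-sublist : ∀ {xs ys : List B} → xs ⊑ ys → Sublist (λ x y → x ≡ f y) (map f xs) ys
  map-sublist [] = []
  map-sublist (y ∷ʳ σ) = y ∷ʳ map-sublist σ
  map-sublist (≡.refl ∷ σ) = ≡.refl ∷ map-sublist σ

  map-sublist-covers : ∀ {xs ys : List B} (σ : xs ⊑ ys) i → ∃ λ i′ → embed (map-sublist σ) i′ ≡ embed σ i
  map-sublist-covers (y ∷ʳ σ) i = map₂ (≡.cong suc) (map-sublist-covers σ i)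
  map-sublist-covers (≡.refl ∷ σ) zero = zero , ≡.refl
  map-sublist-covers (≡.refl ∷ σ) (suc i) with map-sublist-covers σ i
  ... | i′ , eq = suc i′ , ≡.cong suc eq

  map-sublist-into : ∀ {xs ys : List B} (σ : xs ⊑ ys) i → ∃ λ i′ → embed σ i′ ≡ embed (map-sublist σ) i
  map-sublist-into (y ∷ʳ σ) i = map₂ (≡.cong suc) (map-sublist-into σ i)
  map-sublist-into (≡.refl ∷ σ) zero = zero , ≡.refl
  map-sublist-into (≡.refl ∷ σ) (suc i) with map-sublist-into σ i
  ... | i′ , eq = suc i′ , ≡.cong suc eq

covers⇒∣p∣≤length : ∀ {A B : Set} {R : A → B → Set} {xs ys} (σ : Sublist R xs ys) {p} →
  (∀ {j} → j ∈ p → ∃ λ i → embed σ i ≡ j) → ∣ p ∣ ≤ length xs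
covers⇒∣p∣≤length {xs = xs} σ {p} covers = ℕ.≤-trans (p⊆q⇒∣p∣≤∣q∣ p⊆image)
  (ℕ.≤-reflexive (≡.trans (∣image∣ σ ⊤) (∣⊤∣≡n (length xs))))
  where
  p⊆image : p ⊆ image σ ⊤
  p⊆image j∈p with covers j∈p
  ... | i , ≡.refl = ∈-image⁺ σ ∈⊤

AllPairs-lookup : ∀ {A : Set} {R : A → A → Set} {xs} → AllPairs R xs → ∀ {i j} → i Fin.< j →
  R (List.lookup xs i) (List.lookup xs j)
AllPairs-lookup {xs = x ∷ xs} (Rx ∷ _) {zero} {suc j} _ = All.lookup Rx (∈-lookup j)
AllPairs-lookup {xs = x ∷ xs} (_ ∷ Rxs) {suc i} {suc j} i<j = AllPairs-lookup Rxs (ℕ.s<s⁻¹ i<j)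

-- Intervals of consecutive points in the plane

position : Fin 2 → ℕ → ℕ
position l r = toℕ l ℕ.+ r * 2

mod-class-position : ∀ {m} {j : Fin m} l r → toℕ j ≡ position l r → mod-class 2 j ≡ l
mod-class-position l r j≡ = toℕ-injective (≡.trans (toℕ-fromℕ< _) (≡.trans (≡.cong (_% 2) j≡)
  (≡.trans ([m+kn]%n≡m%n (toℕ l) r 2) (m<n⇒m%n≡m (toℕ<n l)))))

mod-class-1+position : ∀ {m} {j : Fin m} {l u} r → l ≢ u → toℕ j ≡ suc (position l r) → mod-class 2 j ≡ u
mod-class-1+position {l = zero} {zero} r l≢u j≡ = contradiction ≡.refl l≢u
mod-class-1+position {l = zero} {suc zero} r l≢u j≡ = mod-class-position (suc zero) r j≡
mod-class-1+position {l = suc zero} {zero} r l≢u j≡ = mod-class-position zero (suc r) j≡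
mod-class-1+position {l = suc zero} {suc zero} r l≢u j≡ = contradiction ≡.refl l≢u

-- Of the intervals with k + 1 points only n / (k + 3) are used, a number that fits with room to
-- spare; the factor 2 is the cost of rounding. With no points the empty set is the single member.
intervalBound : ℕ → ℕ
intervalBound zero = 1
intervalBound (suc k) = 2 * (k ℕ.+ 3)

module Intervals (F : OrderedField) where
  open OrderedField F hiding (zero; _-_) renaming (_*_ to _*ᶠ_)
  open Geometry F
  open OrderedFieldProperties F hiding (begin_; begin-strict_; begin-equality_; step-<; step-≤; step-≈-⟩; step-≈-⟨; _∎)
  open Convexity F
  open Separation F
  open Merging F

  private
    variable
      n m e : ℕ

  UnderHull-cong : ∀ {v v′ : Fin n → Point e} {h h′ : Fin n → Carrier} {S a} → (∀ j → v j ≡ v′ j) →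
      (∀ j → h j ≈ h′ j) →
    UnderHull v h S a → UnderHull v′ h′ S a
  UnderHull-cong {n = n} {v = v} {v′} {h} {h′} {S} {a} v≡v′ h≈h′ U = record
    { weight = weight ; nonneg = nonneg ; supported = supported ; total = total
    ; combines = λ c → trans (∑-cong {n} λ j → *-congˡ (v≈ j c)) (trans (combines c) (sym (v≈ a c)))
    ; height = ≤-trans (inj₂ (sym (h≈h′ a))) (≤-trans height (inj₂ (∑-cong {n} λ j → *-congˡ (h≈h′ j)))) }
    where
    open UnderHull U
    v≈ : ∀ j c → v′ j c ≈ v j c
    v≈ j c = reflexive (≡.cong (λ x → x c) (≡.sym (v≡v′ j)))

  UnderHull-average : ∀ {v : Fin n → Point e} {h} {S a} (U : UnderHull v h S a) (x : Fin n → Carrier) →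
    (∀ {j} → j ∈ S → x j <ᶠ 0#) → ∑ n (λ j → UnderHull.weight U j *ᶠ x j) <ᶠ 0#
  UnderHull-average {n} {S = S} U x x<0 with any? (λ j → ¬? (UnderHull.weight U j ≟ 0#))
  ... | yes (j , μj≉0) = ∑-weighted-neg (UnderHull.nonneg U) (UnderHull.supported U) (λ j∈S → inj₁ (x<0 j∈S))
          (nonneg∧≉0⇒pos (UnderHull.nonneg U j) μj≉0) (x<0 (Supported-pos (UnderHull.supported U) μj≉0))
  ... | no none = contradiction (trans (sym (UnderHull.total U))
          (∑-zero {n} λ j → decidable-stable (UnderHull.weight U j ≟ 0#) λ μj≉0 → none (j , μj≉0))) 1≉0

  module _ {v : Fin n → Point (suc e)} (v-mono : ∀ {i j} → i Fin.< j → v i zero <ᶠ v j zero) where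

    -- If no point of `S` were left of `a`, all of `S` would be strictly to its right, and so would
    -- every convex combination; likewise with the sides exchanged.
    UnderHull-between : ∀ {h S a} → a ∉ S → UnderHull v h S a →
      (∃ λ j → j ∈ S × j Fin.< a) × (∃ λ j → j ∈ S × a Fin.< j)
    UnderHull-between {h} {S} {a} a∉S U = left (any? λ j → (j ∈? S) ×-dec (j Fin.<? a)) ,
                                          right (any? λ j → (j ∈? S) ×-dec (a Fin.<? j))
      where
      open UnderHull U
      v₀ : Fin n → Carrier
      v₀ j = v j zero
      ∑-const : ∑ n (λ j → weight j *ᶠ v₀ a) ≈ v₀ a
      ∑-const = trans (∑-*ʳ weight (v₀ a)) (trans (*-congʳ total) (*-identityˡ (v₀ a)))
      neg-difference : ∀ {x y} → x <ᶠ y → (x + (- y)) <ᶠ 0#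
      neg-difference x<y = <-respʳ (-‿inverseʳ _) (<-+-mono _ x<y)
      ≮∧≢⇒> : ∀ {i j : Fin n} → ¬ (i Fin.< j) → i ≢ j → j Fin.< i
      ≮∧≢⇒> i≮j i≢j = ℕ.≤∧≢⇒< (ℕ.≮⇒≥ i≮j) (i≢j ∘ toℕ-injective ∘ ≡.sym)
      left : Dec (∃ λ j → j ∈ S × j Fin.< a) → ∃ λ j → j ∈ S × j Fin.< a
      left (yes found) = found
      left (no none) = contradiction
        (UnderHull-average U (λ j → v₀ a + (- v₀ j)) λ {j} j∈S → neg-difference
          (v-mono (≮∧≢⇒> (λ j<a → none (j , j∈S , j<a)) λ { ≡.refl → a∉S j∈S })))
        (irrefl (trans (∑-difference weight (λ _ → v₀ a) v₀)
            (trans (+-cong ∑-const (-‿cong (combines zero))) (-‿inverseʳ _))))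
      right : Dec (∃ λ j → j ∈ S × a Fin.< j) → ∃ λ j → j ∈ S × a Fin.< j
      right (yes found) = found
      right (no none) = contradiction
        (UnderHull-average U (λ j → v₀ j + (- v₀ a)) λ {j} j∈S → neg-difference
          (v-mono (≮∧≢⇒> (λ a<j → none (j , j∈S , a<j)) λ { ≡.refl → a∉S j∈S })))
        (irrefl (trans (∑-difference weight v₀ (λ _ → v₀ a))
            (trans (+-cong (combines zero) (-‿cong ∑-const)) (-‿inverseʳ _))))

    module _ (h : Fin n → Carrier) {l u : Fin 2} (l≢u : l ≢ u)
      (cap : UnderHyperplanes v (λ j → - h j) (classes 2 n ⁅ u ⁆) (classes 2 n ⁅ l ⁆)) where

      -- In an interval of three points the outer two belong to class l and the middle one
      -- to class u, hence it forms a cap.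
      interval-hullFree : ∀ mode k r → (mode ≡ hole → k ≤ 3) → HullFree mode v h (interval n (position l r) k)
      interval-hullFree mode k r k≤3 a guard U with UnderHull-between (x∉p-x (interval n (position l r) k) a) U
      ... | (y , y∈ , y<a) , (z , z∈ , a<z) = case mode k≤3 guard
        where
        I = interval n (position l r) k
        s≤y : position l r ≤ toℕ y
        s≤y = proj₁ (∈-interval⁻ (x∈p-y⇒x∈p a y∈))
        z<s+k : toℕ z ℕ.< position l r ℕ.+ k
        z<s+k = proj₂ (∈-interval⁻ {s = position l r} (x∈p-y⇒x∈p a z∈))
        case : ∀ mode → (mode ≡ hole → k ≤ 3) → Guard mode I a → ⊥′
        case island _ a∉I = a∉I (∈-interval⁺ (ℕ.≤-trans s≤y (ℕ.<⇒≤ y<a)) (ℕ.<-trans a<z z<s+k))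
        case hole k≤3 _ = over⇒¬underHull v h (classes 2 n ⁅ u ⁆) (classes 2 n ⁅ l ⁆) cap outer
          (∈-classes⁺ 2 {J = ⁅ u ⁆} {a} (≡.subst (_∈ ⁅ u ⁆) (≡.sym (mod-class-1+position r l≢u a≡1+s)) (x∈⁅x⁆ u))) U
          where
          a≡1+s : toℕ a ≡ suc (position l r)
          a≡1+s = ℕ.≤-antisym (ℕ.s≤s⁻¹ (ℕ.s≤s⁻¹ (begin
              suc (suc (toℕ a))      ≤⟨ ℕ.s≤s a<z ⟩
              suc (toℕ z)            ≤⟨ z<s+k ⟩
              position l r ℕ.+ k        ≤⟨ ℕ.+-monoʳ-≤ (position l r) (k≤3 ≡.refl) ⟩
              position l r ℕ.+ 3        ≡⟨ ℕ.+-comm (position l r) 3 ⟩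
              3 ℕ.+ position l r        ∎))) (ℕ.≤-trans (ℕ.s≤s s≤y) y<a)
            where open ℕ.≤-Reasoning
          ends : ∀ {x} → position l r ≤ x → x ℕ.≤ 2 ℕ.+ position l r → x ≢ suc (position l r) →
              x ≡ position l r ⊎ x ≡ position l (suc r)
          ends {x} s≤x x≤2+s x≢1+s with ℕ.m≤n⇒m<n∨m≡n s≤x
          ... | inj₂ s≡x = inj₁ (≡.sym s≡x)
          ... | inj₁ s<x = inj₂ (≡.trans (ℕ.≤-antisym x≤2+s (ℕ.≤∧≢⇒< s<x (x≢1+s ∘ ≡.sym)))
                  (≡.trans (ℕ.+-comm 2 (position l r)) (≡.trans (ℕ.+-assoc (toℕ l) (r * 2) 2)
                      (≡.cong (toℕ l ℕ.+_) (ℕ.+-comm (r * 2) 2)))))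
          outer : I - a ⊆ classes 2 n ⁅ l ⁆
          outer {x} x∈ with ∈-interval⁻ {s = position l r} (x∈p-y⇒x∈p a x∈)
          ... | s≤x , x<s+k with ends s≤x (ℕ.s≤s⁻¹ (ℕ.≤-trans x<s+k
              (ℕ.≤-trans (ℕ.+-monoʳ-≤ (position l r) (k≤3 ≡.refl))
                  (ℕ.≤-reflexive (ℕ.+-comm (position l r) 3)))))
                  (λ x≡1+s → x∉p-x I a (≡.subst (_∈ I - a) (toℕ-injective (≡.trans x≡1+s (≡.sym a≡1+s))) x∈))
          ...   | inj₁ x≡s = ∈-classes⁺ 2 {J = ⁅ l ⁆} {x}
              (≡.subst (_∈ ⁅ l ⁆) (≡.sym (mod-class-position l r x≡s)) (x∈⁅x⁆ l))
          ...   | inj₂ x≡s+2 = ∈-classes⁺ 2 {J = ⁅ l ⁆} {x}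
              (≡.subst (_∈ ⁅ l ⁆) (≡.sym (mod-class-position l (suc r) x≡s+2)) (x∈⁅x⁆ l))

      -- The start of the interval is the one free choice, and for k = 0 there is none, whence the
      -- exponent `1 ⊓ k`. The case k = 0 does arise, from halving k = 1.
      intervalFamily : ∀ mode k → (mode ≡ hole → k ≤ 3) → k ℕ.+ 8 ≤ n →
        Family (HullFree mode v h) k (1 ⊓ k) (intervalBound k)
      intervalFamily mode zero k≤3 _ = record
        { list = interval n (position l 0) 0 ∷ []
        ; unique = All.[] ∷ []
        ; members = (≡.trans (≡.cong ∣_∣ empty) (∣⊥∣≡0 n) , interval-hullFree mode 0 0 k≤3) All.∷ All.[]
        ; count = ℕ.≤-refl }
        where
        empty : interval n (position l 0) 0 ≡ ⊥
        empty = Empty-unique λ (x , x∈) → let (s≤x , x<s+0) = ∈-interval⁻ {s = position l 0} x∈ in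
          ℕ.<⇒≱ x<s+0 (ℕ.≤-trans (ℕ.≤-reflexive (ℕ.+-identityʳ (position l 0))) s≤x)
      intervalFamily mode (suc k) k≤3 k+9≤n = record
        { list = applyUpTo I R
        ; unique = Unique.applyUpTo⁺₁ I R λ {i} {j} i<j j<R Ii≡Ij → I-≢ i<j (ℕ.<-trans i<j j<R) Ii≡Ij
        ; members = All.applyUpTo⁺₁ I R λ {i} i<R →
            ∣interval∣ n (position l i) (suc k) (fits i<R) , interval-hullFree mode (suc k) i k≤3
        ; count = begin
            n ^ 1                                  ≡⟨ ℕ.*-identityʳ n ⟩
            n                                      ≤⟨ m≤2*n*[m/n] n (k ℕ.+ 3) 1≤R ⟩
            2 * (k ℕ.+ 3) * R                      ≡⟨ ≡.cong (2 * (k ℕ.+ 3) *_) (length-applyUpTo I R) ⟨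
            2 * (k ℕ.+ 3) * length (applyUpTo I R) ∎ }
        where
        open ℕ.≤-Reasoning
        instance
          k+3-nonZero : NonZero (k ℕ.+ 3)
          k+3-nonZero = ℕ.≢-nonZero λ k+3≡0 → contradiction (≡.trans (ℕ.+-comm 3 k) k+3≡0) λ ()
        R : ℕ
        R = n / (k ℕ.+ 3)
        I : ℕ → Subset n
        I r = interval n (position l r) (suc k)
        1≤R : 1 ≤ R
        1≤R = m*n≤o⇒m≤o/n (k ℕ.+ 3) (begin
          1 * (k ℕ.+ 3) ≡⟨ ℕ.*-identityˡ (k ℕ.+ 3) ⟩
          k ℕ.+ 3       ≤⟨ ℕ.+-mono-≤ (ℕ.n≤1+n k) (ℕ.m≤m+n 3 5) ⟩
          suc k ℕ.+ 8   ≤⟨ k+9≤n ⟩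
          n             ∎)
        fits : ∀ {r} → r ℕ.< R → position l r ℕ.+ suc k ≤ n
        fits {r} r<R = begin
          toℕ l ℕ.+ r * 2 ℕ.+ suc k          ≤⟨ ℕ.+-monoˡ-≤ (suc k)
              (ℕ.+-mono-≤ (ℕ.s≤s⁻¹ (toℕ<n l)) (ℕ.*-monoʳ-≤ r (ℕ.≤-trans (ℕ.n≤1+n 2) (ℕ.m≤n+m 3 k)))) ⟩
          suc (r * (k ℕ.+ 3)) ℕ.+ suc k      ≡⟨ ℕ.+-comm (suc (r * (k ℕ.+ 3))) (suc k) ⟩
          suc k ℕ.+ suc (r * (k ℕ.+ 3))      ≡⟨ ℕ.+-suc (suc k) (r * (k ℕ.+ 3)) ⟩
          2 ℕ.+ k ℕ.+ r * (k ℕ.+ 3)          ≡⟨ ≡.cong (ℕ._+ r * (k ℕ.+ 3)) (ℕ.+-comm 2 k) ⟩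
          k ℕ.+ 2 ℕ.+ r * (k ℕ.+ 3)          ≤⟨ ℕ.+-monoˡ-≤ (r * (k ℕ.+ 3)) (ℕ.+-monoʳ-≤ k (ℕ.n≤1+n 2)) ⟩
          suc r * (k ℕ.+ 3)                  ≤⟨ ℕ.*-monoˡ-≤ (k ℕ.+ 3) r<R ⟩
          R * (k ℕ.+ 3)                      ≤⟨ m/n*n≤m n (k ℕ.+ 3) ⟩
          n                                  ∎
        -- The first index of `I i` precedes all of `I j`.
        I-≢ : ∀ {i j} → i ℕ.< j → i ℕ.< R → I i ≢ I j
        I-≢ {i} {j} i<j i<R Ii≡Ij = ℕ.<⇒≱ s<s′ (ℕ.≤-trans
            (proj₁ (∈-interval⁻ (≡.subst (x ∈_) Ii≡Ij x∈))) (ℕ.≤-reflexive (toℕ-fromℕ< s<n)))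
          where
          s<s′ : position l i ℕ.< position l j
          s<s′ = ℕ.+-monoʳ-< (toℕ l) (ℕ.*-monoˡ-< 2 i<j)
          s<n : position l i ℕ.< n
          s<n = ℕ.≤-trans (ℕ.≤-trans (ℕ.≤-reflexive (ℕ.+-comm 1 (position l i)))
              (ℕ.+-monoʳ-≤ (position l i) (ℕ.s≤s ℕ.z≤n))) (fits i<R)
          x : Fin n
          x = Fin.fromℕ< s<n
          x∈ : x ∈ I i
          x∈ = ∈-interval⁺ (ℕ.≤-reflexive (≡.sym (toℕ-fromℕ< s<n)))
            (ℕ.≤-trans (ℕ.s≤s (ℕ.≤-reflexive (toℕ-fromℕ< s<n)))
                (ℕ.≤-trans (ℕ.≤-reflexive (ℕ.+-comm 1 (position l i))) (ℕ.+-monoʳ-≤ (position l i) (ℕ.s≤s ℕ.z≤n))))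

-- The summand e + 8 of the threshold keeps every residue class large enough to span hyperplanes.
countBound threshold : ℕ → ℕ → ℕ
countBound zero k = intervalBound k
countBound (suc e) k =
  (2 * primeSeq e) ^ (2 ^ e ⊓ ⌊ k /2⌋) * countBound e ⌊ k /2⌋ *
  ((2 * primeSeq e) ^ (2 ^ e ⊓ ⌈ k /2⌉) * countBound e ⌈ k /2⌉)

threshold zero k = k ℕ.+ 8
threshold (suc e) k = (threshold e ⌊ k /2⌋ ℕ.+ threshold e ⌈ k /2⌉ ℕ.+ (e ℕ.+ 8)) * primeSeq e

8≤threshold : ∀ e k → 8 ≤ threshold e k
8≤threshold zero k = ℕ.m≤n+m 8 k
8≤threshold (suc e) k = ℕ.≤-trans (ℕ.≤-trans (ℕ.m≤n+m 8 e) (ℕ.m≤n+m (e ℕ.+ 8) sizes))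
  (ℕ.m≤m*n (sizes ℕ.+ (e ℕ.+ 8)) (primeSeq e) {{primeSeq-nz e}})
  where
  sizes : ℕ
  sizes = threshold e ⌊ k /2⌋ ℕ.+ threshold e ⌈ k /2⌉

n≤6m⇒⌈n/2⌉≤3m : ∀ {k} m → k ≤ 3 * (2 * m) → ⌈ k /2⌉ ≤ 3 * m
n≤6m⇒⌈n/2⌉≤3m m k≤ = n≤2m⇒⌈n/2⌉≤m (3 * m) (ℕ.≤-trans k≤ (ℕ.≤-reflexive
  (≡.trans (≡.sym (ℕ.*-assoc 3 2 m)) (≡.trans (≡.cong (_* m) (ℕ.*-comm 3 2)) (ℕ.*-assoc 2 3 m)))))

-- Recursion over the dimension

module HortonSets (F : OrderedField) where
  open OrderedField F hiding (zero; _-_) renaming (_*_ to _*ᶠ_)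
  open Geometry F
  open OrderedFieldProperties F hiding (begin_; begin-strict_; begin-equality_; step-<; step-≤; step-≈-⟩; step-≈-⟨; _∎)
  open Convexity F
  open Separation F
  open Selection F
  open Merging F
  open Intervals F

  -- This unites two sources of sets: in the plane they are subsets of the class itself, in higher
  -- dimensions subsets of its list of projections. Merging only needs their indices in `H`.
  record ClassFamily {d e} (H : List (Point d)) (C : Subset (length H)) (mode : Mode)
      (v : Fin (length H) → Point e) (h : Fin (length H) → Carrier) (k x c : ℕ) : Set₁ where
    field
      {X} : Set
      {R} : X → Point d → Set
      {xs} : List X
      embedding : Sublist R xs H
      covers : ∀ {j} → j ∈ C → ∃ λ i → embed embedding i ≡ j
      into : ∀ i → embed embedding i ∈ C
      family : Family (HullFree mode (v ∘ embed embedding) (h ∘ embed embedding)) k x c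

  private
    variable
      e : ℕ

  horton-sorted : ∀ {H : List (Point (suc (suc e)))} → Horton (suc (suc e)) H → SortedByFirst H
  horton-sorted (horton _ sorted _ _) = sorted

  horton-generalPosition : ∀ {H : List (Point (suc (suc e)))} → Horton (suc (suc e)) H → GeneralPosition H
  horton-generalPosition (horton _ _ (gp , _) _) = gp

  horton-cases : ∀ {H : List (Point (suc (suc e)))} → Horton (suc (suc e)) H → 2 ≤ length H →
    ProjCond e H × (∀ i → Horton (suc (suc e)) (classOf (primeSeq e) {{primeSeq-nz e}} i H)) × SplitCond e H
  horton-cases (horton _ _ _ (inj₁ n≤1)) 2≤n = contradiction n≤1 (ℕ.<⇒≱ 2≤n)
  horton-cases (horton _ _ _ (inj₂ cases)) _ = cases

  ConvFree⇒HullFree : ∀ {n d} (v : Fin n → Point d) (h : Fin n → Carrier) {mode} (H : List (Point d))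
      (ι : Fin (length H) → Fin n) →
    (∀ i → pt H i ≡ v (ι i)) → ∀ {I} → ConvFree mode H I → HullFree mode (v ∘ ι) (h ∘ ι) I
  ConvFree⇒HullFree v h H ι pt≡v free a guard U = free a guard (weight , nonneg , supported , total ,
    λ c → trans (∑-cong {length H} λ j → *-congˡ (pt≈v j c)) (trans (combines c) (sym (pt≈v a c))))
    where
    open UnderHull U
    pt≈v : ∀ i c → pt H i c ≈ _
    pt≈v i c = reflexive (≡.cong (λ x → x c) (pt≡v i))

  -- A share of e + 4 points per class meets both size demands of `splitting`; in the plane this
  -- amounts to 4 · 2 = 8 points, the summand 8 in `threshold zero`.
  hortonSplitting : ∀ {e} (H : List (Point (suc (suc e)))) → Horton (suc (suc e)) H →
      (e ℕ.+ 4) * primeSeq e ≤ length H →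
    Splitting (primeSeq e) {{primeSeq-nz e}} H
  hortonSplitting {e} H H-horton n≥ = splitting H (horton-generalPosition H-horton)
      (proj₂ (proj₂ (horton-cases H-horton
      (ℕ.≤-trans (ℕ.s≤s (ℕ.s≤s ℕ.z≤n)) 3+e≤n)))) 3+e≤n
    (ℕ.≤-trans (ℕ.≤-trans (ℕ.≤-reflexive (ℕ.+-comm 2 e)) (ℕ.+-monoʳ-≤ e (ℕ.m≤m+n 2 2)))
      (m*n≤o⇒m≤o/n (primeSeq e) {{primeSeq-nz e}} n≥))
    where
    3+e≤n : 3 ℕ.+ e ≤ length H
    3+e≤n = ℕ.≤-trans (ℕ.≤-reflexive (ℕ.+-comm 3 e)) (ℕ.≤-trans (ℕ.+-monoʳ-≤ e (ℕ.n≤1+n 3))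
      (ℕ.≤-trans (ℕ.m≤m*n (e ℕ.+ 4) (primeSeq e) {{primeSeq-nz e}}) n≥))

  -- The lower part of a Horton set is treated as an upper part with negated last coordinates.
  SignedClassFamilies : ∀ {e} (H : List (Point (suc (suc e)))) (C : Subset (length H)) (mode : Mode) (k x c : ℕ) →
      Set₁
  SignedClassFamilies H C mode k x c =
    ClassFamily H C mode (π ∘ pt H) (lastCoord ∘ pt H) k x c ×
    ClassFamily H C mode (π ∘ pt H) (λ j → - lastCoord (pt H j)) k x c

  -- The class is itself Horton, so one parity within the class is deep below the other. Starting at
  -- the lower parity yields caps, for the upper side of a merge; starting at the higher one yields
  -- cups, which are caps once the heights are negated.
  planarClassFamilies : ∀ mode k → (mode ≡ hole → k ≤ 3) → (H : List (Point 2)) (c : Fin 2) →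
    Horton 2 (classOf 2 c H) → k ℕ.+ 8 ≤ length (classOf 2 c H) →
    SignedClassFamilies H (classes 2 (length H) ⁅ c ⁆) mode k (1 ⊓ k) (intervalBound k)
  planarClassFamilies mode k k≤3 H c K-horton k+8≤∣K∣ =
    classFamily (intervalFamily v-mono hK (Splitting.j≢i s ∘ ≡.sym)
      (UnderHyperplanes-mono vK (λ x → - hK x) (Splitting.Cⱼ⊆A s) (Splitting.Cᵢ⊆B s) (Splitting.A>B s)) mode k k≤3
          k+8≤∣K∣)
      last≈ ,
    classFamily (intervalFamily v-mono (λ x → - hK x) (Splitting.j≢i s)
      (UnderHyperplanes-cong vK (λ x → sym (-‿involutive (hK x)))
        (UnderHyperplanes-mono vK hK (Splitting.Cᵢ⊆B s) (Splitting.Cⱼ⊆A s) (Splitting.B<A s))) mode k k≤3 k+8≤∣K∣)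
      (λ i → -‿cong (last≈ i))
    where
    K = classOf 2 c H
    σ : K ⊑ H
    σ = union-⊑ 2 ⁅ c ⁆ H
    s : Splitting 2 K
    s = hortonSplitting K K-horton (ℕ.≤-trans (ℕ.m≤n+m 8 k) k+8≤∣K∣)
    vK : Fin (length K) → Point 1
    vK = π ∘ pt K
    hK : Fin (length K) → Carrier
    hK = lastCoord ∘ pt K
    last≈ : ∀ i → lastCoord (pt H (embed σ i)) ≈ hK i
    last≈ i = reflexive (≡.cong lastCoord (≡.sym (lookup-embed σ i)))
    v-mono : ∀ {i j} → i Fin.< j → vK i zero <ᶠ vK j zero
    v-mono = AllPairs-lookup (Linked⇒AllPairs (λ {x} {y} {z} → <-trans {firstCoord x} {firstCoord y} {firstCoord z})
        (horton-sorted K-horton))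
    classFamily : ∀ {hH : Fin (length H) → Carrier} {hK : Fin (length K) → Carrier} →
      Family (HullFree mode vK hK) k (1 ⊓ k) (intervalBound k) → (∀ i → hH (embed σ i) ≈ hK i) →
      ClassFamily H (classes 2 (length H) ⁅ c ⁆) mode (π ∘ pt H) hH k (1 ⊓ k) (intervalBound k)
    classFamily f hH≈hK = record
      { embedding = σ ; covers = union-surjective 2 ⁅ c ⁆ H
      ; into = λ i → ∈-classes⁺ 2 (union-class 2 ⁅ c ⁆ H i)
      ; family = Family-map (λ free a guard U → free a guard
          (UnderHull-cong (λ j → ≡.cong π (≡.sym (lookup-embed σ j))) hH≈hK U)) f }

  -- A point under a hull projects into the projected hull, so with `ConvFree` projections any
  -- height function will do, whatever its sign.
  projectedClassFamily : ∀ {e mode k x C} (H : List (Point (suc (suc (suc e))))) (c : Fin (primeSeq (suc e))) →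
    Family (ConvFree mode (map π (classOf (primeSeq (suc e)) {{primeSeq-nz (suc e)}} c H))) k x C →
    ∀ h → ClassFamily H (classes (primeSeq (suc e)) {{primeSeq-nz (suc e)}} (length H) ⁅ c ⁆) mode (π ∘ pt H) h k x C
  projectedClassFamily {e} H c f h = record
    { embedding = map-sublist π σ
    ; covers = λ j∈C → let (i , eq) = union-surjective p ⁅ c ⁆ H j∈C
                           (i′ , eq′) = map-sublist-covers π σ i in i′ , ≡.trans eq′ eq
    ; into = λ i → let (i′ , eq) = map-sublist-into π σ i in
        ≡.subst (_∈ classes p (length H) ⁅ c ⁆) eq (∈-classes⁺ p (union-class p ⁅ c ⁆ H i′))
    ; family = Family-map (ConvFree⇒HullFree (π ∘ pt H) h (map π (classOf p c H)) (embed (map-sublist π σ))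
        (lookup-embed (map-sublist π σ))) f }
    where
    p = primeSeq (suc e)
    instance
      p-nonZero : NonZero p
      p-nonZero = primeSeq-nz (suc e)
    σ : classOf p c H ⊑ H
    σ = union-⊑ p ⁅ c ⁆ H

  mergedFamily : ∀ {e p mode k₁ k₂ x₁ x₂ C₁ C₂} .{{_ : NonZero p}} {H : List (Point (suc (suc e)))}
      (s : Splitting p H) →
    let open Splitting s in 1 ≤ length H / p →
    ClassFamily H Cⱼ mode v h k₁ x₁ C₁ → ClassFamily H Cᵢ mode v (λ x → - h x) k₂ x₂ C₂ →
    Family (ConvFree mode H) (k₁ ℕ.+ k₂) (x₁ ℕ.+ x₂) ((2 * p) ^ x₁ * C₁ * ((2 * p) ^ x₂ * C₂))
  mergedFamily {p = p} {mode} {H = H} s 1≤n/p upper lower =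
      Family-∪ Upper.embedding Lower.embedding embeddings-disjoint (2 * p)
      (size Upper.embedding j Upper.covers) (size Lower.embedding i Lower.covers)
      (merge s Upper.embedding Lower.embedding mode Upper.covers Upper.into Lower.covers Lower.into) Upper.family
          Lower.family
    where
    module Upper = ClassFamily upper
    module Lower = ClassFamily lower
    open Splitting s
    embeddings-disjoint : ∀ x y → embed Upper.embedding x ≢ embed Lower.embedding y
    embeddings-disjoint x y eq = disjoint (Cⱼ⊆A (Upper.into x)) (Cᵢ⊆B (≡.subst (_∈ Cᵢ) (≡.sym eq) (Lower.into y)))
    size : ∀ {X : Set} {R : X → Point _ → Set} {xs} (σ : Sublist R xs H) c →
      (∀ {x} → x ∈ classes p (length H) ⁅ c ⁆ → ∃ λ y → embed σ y ≡ x) → length H ≤ 2 * p * length xs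
    size σ c covers = ℕ.≤-trans (m≤2*n*[m/n] (length H) p 1≤n/p)
      (ℕ.*-monoʳ-≤ (2 * p) (ℕ.≤-trans (∣classes∣≥ p (length H) (x∈⁅x⁆ c)) (covers⇒∣p∣≤length σ covers)))

  mutual

    -- Condition (i) is applied to the class, which is Horton by (ii). The projection of a class
    -- need not be a class of the projection, since the two dimensions use different primes.
    classFamilies : ∀ e mode k → (mode ≡ hole → k ≤ 3 * 2 ^ e) →
        (H : List (Point (suc (suc e)))) (c : Fin (primeSeq e)) →
      Horton (suc (suc e)) (classOf (primeSeq e) {{primeSeq-nz e}} c H) →
      threshold e k ≤ length (classOf (primeSeq e) {{primeSeq-nz e}} c H) →
      SignedClassFamilies H (classes (primeSeq e) {{primeSeq-nz e}} (length H) ⁅ c ⁆) mode k (2 ^ e ⊓ k)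
          (countBound e k)
    classFamilies zero mode k k≤ H c K-horton big = planarClassFamilies mode k k≤ H c K-horton big
    classFamilies (suc e) mode k k≤ H c K-horton big = projectedClassFamily H c f _ , projectedClassFamily H c f _
      where
      K = classOf (primeSeq (suc e)) {{primeSeq-nz (suc e)}} c H
      πK-horton : Horton (suc (suc e)) (map π K)
      πK-horton = proj₁ (horton-cases K-horton (ℕ.≤-trans (ℕ.m≤m+n 2 6) (ℕ.≤-trans (8≤threshold (suc e) k) big)))
      f : Family (ConvFree mode (map π K)) k (2 ^ suc e ⊓ k) (countBound (suc e) k)
      f = families e mode k k≤ (map π K) πK-horton (ℕ.≤-trans big (ℕ.≤-reflexive (≡.sym (length-map π K))))

    -- `families e` rests on `classFamilies e`, and that on `families` one dimension lower or on
    -- intervals. The size k is halved on the way, and its bound for holes with it, down to 3 in the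
    -- plane.
    families : ∀ e mode k → (mode ≡ hole → k ≤ 3 * 2 ^ suc e) →
        (H : List (Point (suc (suc e)))) → Horton (suc (suc e)) H →
      threshold (suc e) k ≤ length H → Family (ConvFree mode H) k (2 ^ suc e ⊓ k) (countBound (suc e) k)
    families e mode k k≤ H H-horton big = ≡.subst₂ (λ k′ x → Family (ConvFree mode H) k′ x (countBound (suc e) k))
      (ℕ.⌊n/2⌋+⌈n/2⌉≡n k) (⊓-halves (2 ^ e) k)
      (mergedFamily s (ℕ.≤-trans (ℕ.m≤m+n 1 7) (ℕ.≤-trans (ℕ.m≤n+m 8 e) (ℕ.≤-trans M≥ M≤n/p))) upper lower)
      where
      p = primeSeq e
      instance
        p-nonZero : NonZero p
        p-nonZero = primeSeq-nz e
      a b M : ℕ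
      a = ⌊ k /2⌋
      b = ⌈ k /2⌉
      M = threshold e a ℕ.+ threshold e b ℕ.+ (e ℕ.+ 8)
      M≤n/p : M ≤ length H / p
      M≤n/p = m*n≤o⇒m≤o/n p big
      M≥ : e ℕ.+ 8 ≤ M
      M≥ = ℕ.m≤n+m (e ℕ.+ 8) (threshold e a ℕ.+ threshold e b)
      s : Splitting p H
      s = hortonSplitting H H-horton (ℕ.≤-trans (ℕ.*-monoˡ-≤ p (ℕ.≤-trans (ℕ.+-monoʳ-≤ e (ℕ.m≤m+n 4 4)) M≥)) big)
      open Splitting s using (j; i)
      class-size : ∀ c → M ≤ length (classOf p c H)
      class-size c = ℕ.≤-trans M≤n/p (ℕ.≤-trans (∣classes∣≥ p (length H) (x∈⁅x⁆ c))
        (covers⇒∣p∣≤length (union-⊑ p ⁅ c ⁆ H) (union-surjective p ⁅ c ⁆ H)))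
      class-horton : ∀ c → Horton (suc (suc e)) (classOf p c H)
      class-horton = proj₁ (proj₂ (horton-cases H-horton
          (ℕ.≤-trans (ℕ.m≤m+n 2 6) (ℕ.≤-trans (8≤threshold (suc e) k) big))))
      half≤ : mode ≡ hole → b ≤ 3 * 2 ^ e
      half≤ mode≡hole = n≤6m⇒⌈n/2⌉≤3m (2 ^ e) (k≤ mode≡hole)
      upper : ClassFamily H (classes p (length H) ⁅ j ⁆) mode (π ∘ pt H) (lastCoord ∘ pt H) a (2 ^ e ⊓ a)
          (countBound e a)
      upper = proj₁ (classFamilies e mode a (λ mode≡hole → ℕ.≤-trans (ℕ.⌊n/2⌋≤⌈n/2⌉ k) (half≤ mode≡hole)) H j
          (class-horton j)
        (ℕ.≤-trans (ℕ.≤-trans (ℕ.m≤m+n (threshold e a) (threshold e b)) (ℕ.m≤m+n _ (e ℕ.+ 8))) (class-size j)))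
      lower : ClassFamily H (classes p (length H) ⁅ i ⁆) mode (π ∘ pt H) (λ x → - lastCoord (pt H x)) b (2 ^ e ⊓ b)
          (countBound e b)
      lower = proj₂ (classFamilies e mode b half≤ H i (class-horton i)
        (ℕ.≤-trans (ℕ.≤-trans (ℕ.m≤n+m (threshold e b) (threshold e a)) (ℕ.m≤m+n _ (e ℕ.+ 8))) (class-size i)))

  -- For j outside `I`, removing j changes nothing, so weights on `I` are also weights on `I - j`.
  ConvFree⇒island : ∀ {d} mode {H : List (Point d)} {I} → ConvFree mode H I → ∀ j → InConv H I (pt H j) → j ∈ I
  ConvFree⇒island mode {H} {I} free j (μ , nonneg , supported , total , combines) =
    decidable-stable (j ∈? I) λ j∉I → free j (guard mode j∉I)
        (μ , nonneg , (λ i i∉ → supp j∉I i (x∉p-y⇒x∉p⊎x≡y i∉)) , total , combines)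
    where
    guard : ∀ mode → j ∉ I → Guard mode I j
    guard island j∉I = j∉I
    guard hole _ = tt
    supp : j ∉ I → ∀ i → i ∉ I ⊎ i ≡ j → μ i ≈ 0#
    supp j∉I i (inj₁ i∉I) = supported i i∉I
    supp j∉I i (inj₂ ≡.refl) = supported j j∉I

theorem5 : ∀ (d k : ℕ) → 2 ≤ d → 1 ≤ k →
    ∃ λ (C : ℕ) → ∃ λ (n₀ : ℕ) →
    ∀ (F : OrderedField) → (H : List (Geometry.Point F d)) →
    Geometry.Horton F d H → n₀ ≤ length H →
    (∃ λ (L : List (Subset (length H))) →
    Unique L × All (Geometry.IsIsland F k H) L ×
    length H ^ (2 ^ (d ∸ 1) ⊓ k) ≤ C * length L)
    × (k ≤ 3 * 2 ^ (d ∸ 1) →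
    ∃ λ (L : List (Subset (length H))) →
    Unique L × All (Geometry.IsHole F k H) L ×
    length H ^ (2 ^ (d ∸ 1) ⊓ k) ≤ C * length L)
-- Both constants depend on e = d - 2 and k alone; they precede the choice of the field and serve
-- islands and holes alike.
theorem5 (suc (suc e)) k _ _ = countBound (suc e) k , threshold (suc e) k , λ F H H-horton n₀≤n →
  let open Geometry F
      open Merging F
      open HortonSets F
      module Islands = Family (families e island k (λ ()) H H-horton n₀≤n)
      isIsland : ∀ {mode I} → ∣ I ∣ ≡ k × ConvFree mode H I → IsIsland k H I
      isIsland {mode} (∣I∣≡k , free) = ∣I∣≡k , ConvFree⇒island mode {H} free
  in (Islands.list , Islands.unique , All.map (isIsland {island}) Islands.members , Islands.count) ,
     λ k≤ → let module Holes = Family (families e hole k (λ _ → k≤) H H-horton n₀≤n) in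
       Holes.list , Holes.unique ,
       -- In mode `hole` the guard is trivial, so the members of `I` are tested too, which is convex
       -- position.
       All.map (λ {I} m → isIsland {hole} {I} m , λ j _ → proj₂ m j tt) Holes.members , Holes.count
theorem5 (suc zero) k (ℕ.s≤s ()) _
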